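{- For every binary string $x$, $$\mathrm{C}(x\mid x*)=\max\{\mathrm{C}^X(x) : X \text{ is an infinite binary sequence that extends } x\}+O(1),$$ where the constant in $O(1)$ does not depend on $x$.
   Context: A description mode is a set $D$ of triples $(p,x,y)$ of binary strings such that: (1) $D$ is computably enumerable; (2) for every $p$ and $x$ there is at most one $y$ such that $(p,x,y)\in D$; (3) if $(p,x,y)\in D$ and $x$ is a prefix of $x'$, then $(p,x',y)\in D$. For a description mode $D$ let $\mathrm{C}_D(y\mid x*)=\min\{|p| : (p,x,y)\in D\}$. There exists an optimal description mode, i.e., a $D$ such that $\mathrm{C}_D\le \mathrm{C}_{D'}+O(1)$ for every description mode $D'$; fix such a $D$ and write $\mathrm{C}(y\mid x*)$ for $\mathrm{C}_D(y\mid x*)$. For an infinite binary sequence $X$, $\mathrm{C}^X(x)$ denotes plain Kolmogorov complexity of $x$ relativized to the oracle $X$: $\mathrm{C}^X(x)=\min\{|p| : U^X(p)=x\}$, where $U$ is a fixed optimal oracle decompressor (an oracle machine such that for every oracle machine $V$ there is a constant $c$, not depending on $X$ and $x$, with $\min\{|p|:U^X(p)=x\}\le\min\{|p|:V^X(p)=x\}+c$ for all $X$ and $x$). Thus $\mathrm{C}^X(x)$ is a function of two arguments $x$ and $X$ defined up to an $O(1)$ additive term independent of $X$ and $x$. -}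

module Defs where

open import Data.Bool.Base using (Bool; true; false)
open import Data.List.Base using (List; []; _∷_; length; applyUpTo)
open import Data.List.Relation.Binary.Prefix.Heterogeneous using (Prefix)
open import Data.Nat.Base using (ℕ; zero; suc; _+_; _≤_; _<_)
open import Data.Product.Base using (_×_; _,_; Σ-syntax; ∃-syntax)
open import Function.Bundles using (_⇔_)
open import Relation.Binary.PropositionalEquality.Core using (_≡_)

Str : Set
Str = List Bool

Sequence : Set
Sequence = ℕ → Bool

_IsPrefixOf_ : Str → Str → Set
_IsPrefixOf_ = Prefix _≡_

_Extends_ : Sequence → Str → Set
X Extends x = applyUpTo X (length x) ≡ x

-- Model of computation: the partial recursive functions relative to an
-- oracle X, i.e. the closure of the basic functions and X under composition,
-- primitive recursion and minimization.  Booleans, pairs and lists are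
-- primitive data, so that strings need not be encoded as numbers; on the type
-- nat alone these are the usual partial X-recursive functions.

infixr 6 _⊗_

data Ty : Set where
  bool nat : Ty
  _⊗_      : Ty → Ty → Ty
  list     : Ty → Ty

⟦_⟧ : Ty → Set
⟦ bool ⟧   = Bool
⟦ nat ⟧    = ℕ
⟦ A ⊗ B ⟧  = ⟦ A ⟧ × ⟦ B ⟧
⟦ list A ⟧ = List ⟦ A ⟧

str : Ty
str = list bool

infixr 9 _∙_

data Program : Ty → Ty → Set where
  idn         : ∀ {A} → Program A A
  _∙_         : ∀ {A B C} → Program B C → Program A B → Program A C
  fst         : ∀ {A B} → Program (A ⊗ B) A
  snd         : ∀ {A B} → Program (A ⊗ B) B
  pair        : ∀ {A B C} → Program A B → Program A C → Program A (B ⊗ C)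
  const       : ∀ {A} → Bool → Program A bool
  ifte        : ∀ {A B} → Program A bool → Program A B → Program A B → Program A B
  zer         : ∀ {A} → Program A nat
  succ        : Program nat nat
  natrec      : ∀ {A B} → Program A B → Program (A ⊗ nat ⊗ B) B → Program (A ⊗ nat) B
  nil         : ∀ {A B} → Program A (list B)
  cons        : ∀ {A} → Program (A ⊗ list A) (list A)
  listrec     : ∀ {A B C} → Program A C → Program (A ⊗ B ⊗ list B ⊗ C) C →
                Program (A ⊗ list B) C
  minimize    : ∀ {A} → Program (A ⊗ nat) bool → Program A nat
  query       : Program nat bool

infix 4 _⊢_⟨_⟩⇓_

-- X ⊢ f ⟨ a ⟩⇓ b : with oracle X, program f halts on input a with output b.
data _⊢_⟨_⟩⇓_ (X : Sequence) : ∀ {A B} → Program A B → ⟦ A ⟧ → ⟦ B ⟧ → Set where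
  idn⇓     : ∀ {A} {a : ⟦ A ⟧} → X ⊢ idn {A} ⟨ a ⟩⇓ a
  ∙⇓       : ∀ {A B C} {g : Program B C} {f : Program A B} {a b c} →
             X ⊢ f ⟨ a ⟩⇓ b → X ⊢ g ⟨ b ⟩⇓ c → X ⊢ g ∙ f ⟨ a ⟩⇓ c
  fst⇓     : ∀ {A B} {a : ⟦ A ⟧} {b : ⟦ B ⟧} → X ⊢ fst {A} {B} ⟨ a , b ⟩⇓ a
  snd⇓     : ∀ {A B} {a : ⟦ A ⟧} {b : ⟦ B ⟧} → X ⊢ snd {A} {B} ⟨ a , b ⟩⇓ b
  pair⇓    : ∀ {A B C} {f : Program A B} {g : Program A C} {a b c} →
             X ⊢ f ⟨ a ⟩⇓ b → X ⊢ g ⟨ a ⟩⇓ c → X ⊢ pair f g ⟨ a ⟩⇓ (b , c)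
  const⇓   : ∀ {A} {a : ⟦ A ⟧} {b} → X ⊢ const {A} b ⟨ a ⟩⇓ b
  ifte⇓₁   : ∀ {A B} {t : Program A bool} {f g : Program A B} {a b} →
             X ⊢ t ⟨ a ⟩⇓ true → X ⊢ f ⟨ a ⟩⇓ b → X ⊢ ifte t f g ⟨ a ⟩⇓ b
  ifte⇓₂   : ∀ {A B} {t : Program A bool} {f g : Program A B} {a b} →
             X ⊢ t ⟨ a ⟩⇓ false → X ⊢ g ⟨ a ⟩⇓ b → X ⊢ ifte t f g ⟨ a ⟩⇓ b
  zer⇓     : ∀ {A} {a : ⟦ A ⟧} → X ⊢ zer {A} ⟨ a ⟩⇓ zero
  succ⇓    : ∀ {n} → X ⊢ succ ⟨ n ⟩⇓ suc n
  natrec⇓₀ : ∀ {A B} {z : Program A B} {s : Program (A ⊗ nat ⊗ B) B} {a b} →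
             X ⊢ z ⟨ a ⟩⇓ b → X ⊢ natrec z s ⟨ a , zero ⟩⇓ b
  natrec⇓₁ : ∀ {A B} {z : Program A B} {s : Program (A ⊗ nat ⊗ B) B} {a n b b′} →
             X ⊢ natrec z s ⟨ a , n ⟩⇓ b → X ⊢ s ⟨ a , n , b ⟩⇓ b′ →
             X ⊢ natrec z s ⟨ a , suc n ⟩⇓ b′
  nil⇓     : ∀ {A B} {a : ⟦ A ⟧} → X ⊢ nil {A} {B} ⟨ a ⟩⇓ []
  cons⇓    : ∀ {A} {a : ⟦ A ⟧} {as} → X ⊢ cons {A} ⟨ a , as ⟩⇓ (a ∷ as)
  listrec⇓₀ : ∀ {A B C} {z : Program A C} {s : Program (A ⊗ B ⊗ list B ⊗ C) C} {a c} →
             X ⊢ z ⟨ a ⟩⇓ c → X ⊢ listrec z s ⟨ a , [] ⟩⇓ c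
  listrec⇓₁ : ∀ {A B C} {z : Program A C} {s : Program (A ⊗ B ⊗ list B ⊗ C) C}
             {a b bs c c′} →
             X ⊢ listrec z s ⟨ a , bs ⟩⇓ c → X ⊢ s ⟨ a , b , bs , c ⟩⇓ c′ →
             X ⊢ listrec z s ⟨ a , b ∷ bs ⟩⇓ c′
  minimize⇓ : ∀ {A} {f : Program (A ⊗ nat) bool} {a n} →
             (∀ m → m < n → X ⊢ f ⟨ a , m ⟩⇓ false) → X ⊢ f ⟨ a , n ⟩⇓ true →
             X ⊢ minimize f ⟨ a ⟩⇓ n
  query⇓   : ∀ {n} → X ⊢ query ⟨ n ⟩⇓ X n

-- Computability without an oracle is computability relative to ∅.
∅ : Sequence
∅ _ = false

-- A set of triples is computably enumerable if it is the domain of a partial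
-- computable function (whose values are irrelevant).
ComputablyEnumerable : (Str → Str → Str → Set) → Set
ComputablyEnumerable D =
  Σ[ f ∈ Program (str ⊗ str ⊗ str) bool ]
    ∀ p x y → D p x y ⇔ (∃[ b ] ∅ ⊢ f ⟨ p , x , y ⟩⇓ b)

IsMinimum : (ℕ → Set) → ℕ → Set
IsMinimum P n = P n × (∀ m → P m → n ≤ m)

record DescriptionMode : Set₁ where
  field
    Describes  : Str → Str → Str → Set
    ce         : ComputablyEnumerable Describes
    functional : ∀ {p x y y′} → Describes p x y → Describes p x y′ → y ≡ y′
    monotone   : ∀ {p x x′ y} → x IsPrefixOf x′ → Describes p x y → Describes p x′ y

open DescriptionMode public

-- Complexities take values in ℕ ∪ {∞}; they are represented by their graphs
-- restricted to finite values, the value ∞ (minimum of the empty set) being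
-- the absence of a related number.

-- CondComplexity D y x n : C_D(y | x*) = n.
CondComplexity : DescriptionMode → Str → Str → ℕ → Set
CondComplexity D y x = IsMinimum λ n → ∃[ p ] length p ≡ n × Describes D p x y

-- C_D ≤ C_D′ + O(1) for every D′.
OptimalMode : DescriptionMode → Set₁
OptimalMode D = ∀ (D′ : DescriptionMode) → ∃[ c ] ∀ y x n′ →
  CondComplexity D′ y x n′ → ∃[ n ] CondComplexity D y x n × n ≤ n′ + c

OracleMachine : Set
OracleMachine = Program str str

-- OracleComplexity U X x n : min { |p| : U^X(p) = x } = n.
OracleComplexity : OracleMachine → Sequence → Str → ℕ → Set
OracleComplexity U X x = IsMinimum λ n → ∃[ p ] length p ≡ n × X ⊢ U ⟨ p ⟩⇓ x

OptimalMachine : OracleMachine → Set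
OptimalMachine U = ∀ (V : OracleMachine) → ∃[ c ] ∀ X x n′ →
  OracleComplexity V X x n′ → ∃[ n ] OracleComplexity U X x n × n ≤ n′ + c

-- MaxOracleComplexity U x m : max { C^X(x) : X extends x } = m, where the
-- second component also says that C^X(x) is finite for each such X.
MaxOracleComplexity : OracleMachine → Str → ℕ → Set
MaxOracleComplexity U x m =
  (∃[ X ] X Extends x × OracleComplexity U X x m) ×
  (∀ X → X Extends x → ∃[ n ] OracleComplexity U X x n × n ≤ m)

{-# OPTIONS --safe #-}
-- C^X(x) ≤ C(x | x*) + O(1) for X extending x: given p, search for a triple
-- (p , x′ , y) of the mode with x′ a prefix of X; any two such x′ are comparable,
-- so y is unique.
--
-- C(x | x*) ≤ max C^X(x) + O(1): let T n be the set of y such that every X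
-- extending y has a program of length < n that outputs y.  It is enumerable by
-- compactness of the Cantor space, and a chain (for the prefix order) in T n has
-- fewer than 2^n elements, since all of them are computed from one X.  Colour the
-- elements of T n in the order of enumeration by strings of length n, giving each
-- the first colour not taken by a comparable one.  On a tree order first fit uses
-- no more colours than the length of the longest chain, so 2^n colours suffice, and
-- the colour of y describes y given any extension of y.
module Submission where

open import Defs
open import Axiom.ExcludedMiddle using (ExcludedMiddle)
open import Data.Bool.Base using (Bool; true; false; not; _∧_; _∨_; if_then_else_)
open import Data.Bool.ListAction using (any; all)
open import Data.Bool.Properties using (∨-zeroʳ)
open import Data.Empty using (⊥-elim)
open import Data.List.Base
  using (List; []; _∷_; [_]; _++_; length; map; concatMap; foldr; foldl; reverse; take; drop; downFrom; applyUpTo)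
open import Data.List.Membership.Propositional using (_∈_; _∉_; find; lose)
open import Data.List.Membership.Propositional.Properties
  using (∈-concatMap⁺; ∈-concatMap⁻; ∈-map⁺; ∈-map⁻; ∈-++⁺ˡ; ∈-++⁺ʳ; ∈-++⁻; ∈-∃++; ∈-downFrom⁺; ∈-downFrom⁻)
open import Data.List.Properties
  using (reverse-foldr; unfold-reverse; drop-drop; ++-assoc; ++-identityʳ; length-++; length-applyUpTo;
         applyUpTo-∷ʳ; ∷-injectiveˡ; ∷-injectiveʳ)
open import Data.List.Relation.Binary.Pointwise using (Pointwise-≡⇒≡)
open import Data.List.Relation.Binary.Prefix.Heterogeneous using ([]; _∷_; _++ᵖ_)
import Data.List.Relation.Binary.Prefix.Heterogeneous.Properties as Prefix
open import Data.List.Relation.Unary.All as All using (All; []; _∷_)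
open import Data.List.Relation.Unary.All.Properties using (¬Any⇒All¬; All¬⇒¬Any)
open import Data.List.Relation.Unary.AllPairs using ([]; _∷_)
open import Data.List.Relation.Unary.Any using (here; there)
open import Data.List.Relation.Unary.Unique.Propositional using (Unique)
open import Data.Nat.Base using (ℕ; zero; suc; _+_; _≤_; _<_; z≤n; s≤s; _⊔_; ∣_-_∣)
open import Data.Nat.Properties
open import Data.Product.Base using (_×_; _,_; proj₁; proj₂; Σ-syntax; ∃-syntax)
open import Data.Sum.Base using (_⊎_; inj₁; inj₂; swap)
open import Function.Base using (_∘_; flip; case_of_)
open import Function.Bundles using (_⇔_; mk⇔; Equivalence)
open import Level using (0ℓ)
open import Relation.Binary.Definitions using (tri<; tri≈; tri>)
open import Relation.Binary.PropositionalEquality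
  using (_≡_; _≢_; refl; sym; trans; cong; cong₂; subst; module ≡-Reasoning)
open import Relation.Nullary using (¬_; yes; no)
open import Relation.Nullary.Negation using (contradiction)

-- Computable functions

-- Colours have to be given at once and for good: `T n` is only enumerated, and a shorter comparable
-- string may enter after a longer one, so the rank of a string in its chain cannot serve as its
-- colour. This forces an online rule that never revises a choice. Taking the colours among the
-- strings of length exactly `n` makes `n` readable from the description, so the colourings for all
-- `n` combine into one mode at no cost for encoding `n`. A maximum `m` puts `x` into `T (m + 1)`,
-- and this 1 is the only loss besides the constants of optimality. Excluded middle enters through
-- compactness and through the existence of minima and maxima; all that the mode and the machine
-- compute is given by explicit programs.

⇓-deterministic : ∀ {X A B} {f : Program A B} {a b b′} →
                  X ⊢ f ⟨ a ⟩⇓ b → X ⊢ f ⟨ a ⟩⇓ b′ → b ≡ b′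
⇓-deterministic idn⇓ idn⇓ = refl
⇓-deterministic (∙⇓ p q) (∙⇓ p′ q′) with refl ← ⇓-deterministic p p′ = ⇓-deterministic q q′
⇓-deterministic fst⇓ fst⇓ = refl
⇓-deterministic snd⇓ snd⇓ = refl
⇓-deterministic (pair⇓ p q) (pair⇓ p′ q′) = cong₂ _,_ (⇓-deterministic p p′) (⇓-deterministic q q′)
⇓-deterministic const⇓ const⇓ = refl
⇓-deterministic (ifte⇓₁ p q) (ifte⇓₁ p′ q′) = ⇓-deterministic q q′
⇓-deterministic (ifte⇓₁ p q) (ifte⇓₂ p′ q′) with () ← ⇓-deterministic p p′
⇓-deterministic (ifte⇓₂ p q) (ifte⇓₁ p′ q′) with () ← ⇓-deterministic p p′
⇓-deterministic (ifte⇓₂ p q) (ifte⇓₂ p′ q′) = ⇓-deterministic q q′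
⇓-deterministic zer⇓ zer⇓ = refl
⇓-deterministic succ⇓ succ⇓ = refl
⇓-deterministic (natrec⇓₀ p) (natrec⇓₀ p′) = ⇓-deterministic p p′
⇓-deterministic (natrec⇓₁ p q) (natrec⇓₁ p′ q′) with refl ← ⇓-deterministic p p′ = ⇓-deterministic q q′
⇓-deterministic nil⇓ nil⇓ = refl
⇓-deterministic cons⇓ cons⇓ = refl
⇓-deterministic (listrec⇓₀ p) (listrec⇓₀ p′) = ⇓-deterministic p p′
⇓-deterministic (listrec⇓₁ p q) (listrec⇓₁ p′ q′) with refl ← ⇓-deterministic p p′ = ⇓-deterministic q q′
⇓-deterministic (minimize⇓ {n = n} p q) (minimize⇓ {n = n′} p′ q′) with <-cmp n n′
... | tri< n<n′ _ _ with () ← ⇓-deterministic q (p′ n n<n′)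
... | tri≈ _ n≡n′ _ = n≡n′
... | tri> _ _ n′<n with () ← ⇓-deterministic (p n′ n′<n) q′
⇓-deterministic query⇓ query⇓ = refl

-- One program has to work for every oracle: the same constructions are run with `∅` to show
-- enumerability of a mode and with `X` inside an oracle machine.
record Computable {A B : Ty} (f : ⟦ A ⟧ → ⟦ B ⟧) : Set where
  constructor computable
  field
    program  : Program A B
    computes : ∀ X a → X ⊢ program ⟨ a ⟩⇓ f a

open Computable

infixr 9 _∙ᶜ_

_∙ᶜ_ : ∀ {A B C} {g : ⟦ B ⟧ → ⟦ C ⟧} {f : ⟦ A ⟧ → ⟦ B ⟧} →
       Computable {B} {C} g → Computable {A} {B} f → Computable {A} {C} (g ∘ f)
computable g ⇓g ∙ᶜ computable f ⇓f = computable (g ∙ f) λ X a → ∙⇓ (⇓f X a) (⇓g X _)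

idᶜ : ∀ {A} → Computable {A} {A} (λ a → a)
idᶜ = computable idn λ _ _ → idn⇓

fstᶜ : ∀ {A B} → Computable {A ⊗ B} {A} proj₁
fstᶜ = computable fst λ _ _ → fst⇓

sndᶜ : ∀ {A B} → Computable {A ⊗ B} {B} proj₂
sndᶜ = computable snd λ _ _ → snd⇓

pairᶜ : ∀ {A B C} {f : ⟦ A ⟧ → ⟦ B ⟧} {g : ⟦ A ⟧ → ⟦ C ⟧} →
        Computable {A} {B} f → Computable {A} {C} g → Computable {A} {B ⊗ C} (λ a → f a , g a)
pairᶜ (computable f ⇓f) (computable g ⇓g) = computable (pair f g) λ X a → pair⇓ (⇓f X a) (⇓g X a)

constᶜ : ∀ {A} b → Computable {A} {bool} (λ _ → b)
constᶜ b = computable (const b) λ _ _ → const⇓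

ifᶜ : ∀ {A B} {t : ⟦ A ⟧ → Bool} {f g : ⟦ A ⟧ → ⟦ B ⟧} →
      Computable {A} {bool} t → Computable {A} {B} f → Computable {A} {B} g →
      Computable {A} {B} (λ a → if t a then f a else g a)
ifᶜ {t = t} {f = f} {g} (computable T ⇓t) (computable F ⇓f) (computable G ⇓g) =
  computable (ifte T F G) λ X a → branch X a (t a) (⇓t X a)
  where
  branch : ∀ X a b → X ⊢ T ⟨ a ⟩⇓ b → X ⊢ ifte T F G ⟨ a ⟩⇓ (if b then f a else g a)
  branch X a true  ⇓t = ifte⇓₁ ⇓t (⇓f X a)
  branch X a false ⇓t = ifte⇓₂ ⇓t (⇓g X a)

zeroᶜ : ∀ {A} → Computable {A} {nat} (λ _ → 0)
zeroᶜ = computable zer λ _ _ → zer⇓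

sucᶜ : Computable {nat} {nat} suc
sucᶜ = computable succ λ _ _ → succ⇓

[]ᶜ : ∀ {A B} → Computable {A} {list B} (λ _ → [])
[]ᶜ = computable nil λ _ _ → nil⇓

∷ᶜ : ∀ {A B} {f : ⟦ A ⟧ → ⟦ B ⟧} {g : ⟦ A ⟧ → List ⟦ B ⟧} →
     Computable {A} {B} f → Computable {A} {list B} g → Computable {A} {list B} (λ a → f a ∷ g a)
∷ᶜ f g = computable cons (λ _ _ → cons⇓) ∙ᶜ pairᶜ f g

≗ᶜ : ∀ {A B} {f g : ⟦ A ⟧ → ⟦ B ⟧} → (∀ a → f a ≡ g a) → Computable {A} {B} f → Computable {A} {B} g
≗ᶜ f≗g (computable f ⇓f) = computable f λ X a → subst (X ⊢ f ⟨ a ⟩⇓_) (f≗g a) (⇓f X a)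

-- The recursion equations are hypotheses, so that functions whose definition follows another
-- pattern, such as `drop` here or `reverse` for lists, are covered as well.
natrecᶜ : ∀ {A B} {f : ⟦ A ⊗ nat ⟧ → ⟦ B ⟧} {z : ⟦ A ⟧ → ⟦ B ⟧} {s : ⟦ A ⊗ nat ⊗ B ⟧ → ⟦ B ⟧} →
          Computable {A} {B} z → Computable {A ⊗ nat ⊗ B} {B} s →
          (∀ a → z a ≡ f (a , 0)) → (∀ a n → s (a , n , f (a , n)) ≡ f (a , suc n)) →
          Computable {A ⊗ nat} {B} f
natrecᶜ {f = f} (computable z ⇓z) (computable s ⇓s) f-zero f-suc =
  computable (natrec z s) λ X (a , n) → run X a n
  where
  run : ∀ X a n → X ⊢ natrec z s ⟨ a , n ⟩⇓ f (a , n)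
  run X a zero    = subst (X ⊢ _ ⟨ _ ⟩⇓_) (f-zero a) (natrec⇓₀ (⇓z X a))
  run X a (suc n) = subst (X ⊢ _ ⟨ _ ⟩⇓_) (f-suc a n) (natrec⇓₁ (run X a n) (⇓s X _))

listrecᶜ : ∀ {A B C} {f : ⟦ A ⊗ list B ⟧ → ⟦ C ⟧} {z : ⟦ A ⟧ → ⟦ C ⟧} {s : ⟦ A ⊗ B ⊗ list B ⊗ C ⟧ → ⟦ C ⟧} →
           Computable {A} {C} z → Computable {A ⊗ B ⊗ list B ⊗ C} {C} s →
           (∀ a → z a ≡ f (a , [])) → (∀ a b bs → s (a , b , bs , f (a , bs)) ≡ f (a , b ∷ bs)) →
           Computable {A ⊗ list B} {C} f
listrecᶜ {f = f} (computable z ⇓z) (computable s ⇓s) f-[] f-∷ =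
  computable (listrec z s) λ X (a , bs) → run X a bs
  where
  run : ∀ X a bs → X ⊢ listrec z s ⟨ a , bs ⟩⇓ f (a , bs)
  run X a []       = subst (X ⊢ _ ⟨ _ ⟩⇓_) (f-[] a) (listrec⇓₀ (⇓z X a))
  run X a (b ∷ bs) = subst (X ⊢ _ ⟨ _ ⟩⇓_) (f-∷ a b bs) (listrec⇓₁ (run X a bs) (⇓s X _))

foldrᶜ : ∀ {A B C} {s : ⟦ A ⟧ → ⟦ B ⟧ → ⟦ C ⟧ → ⟦ C ⟧} {z : ⟦ A ⟧ → ⟦ C ⟧} {g : ⟦ A ⟧ → List ⟦ B ⟧} →
         Computable {A ⊗ B ⊗ C} {C} (λ (a , b , c) → s a b c) →
         Computable {A} {C} z → Computable {A} {list B} g →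
         Computable {A} {C} (λ a → foldr (s a) (z a) (g a))
foldrᶜ {s = s} {z} s-comp z-comp g-comp =
  listrecᶜ {f = λ (a , bs) → foldr (s a) (z a) bs} z-comp
    (s-comp ∙ᶜ pairᶜ fstᶜ (pairᶜ (fstᶜ ∙ᶜ sndᶜ) (sndᶜ ∙ᶜ sndᶜ ∙ᶜ sndᶜ)))
    (λ _ → refl) (λ _ _ _ → refl)
  ∙ᶜ pairᶜ idᶜ g-comp


∧ᶜ : ∀ {A} {f g : ⟦ A ⟧ → Bool} → Computable {A} {bool} f → Computable {A} {bool} g →
     Computable {A} {bool} (λ a → f a ∧ g a)
∧ᶜ {f = f} f-comp g-comp = ≗ᶜ (λ a → if≡∧ (f a)) (ifᶜ f-comp g-comp (constᶜ false))
  where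
  if≡∧ : ∀ b {c} → (if b then c else false) ≡ b ∧ c
  if≡∧ true  = refl
  if≡∧ false = refl

∨ᶜ : ∀ {A} {f g : ⟦ A ⟧ → Bool} → Computable {A} {bool} f → Computable {A} {bool} g →
     Computable {A} {bool} (λ a → f a ∨ g a)
∨ᶜ {f = f} f-comp g-comp = ≗ᶜ (λ a → if≡∨ (f a)) (ifᶜ f-comp (constᶜ true) g-comp)
  where
  if≡∨ : ∀ b {c} → (if b then true else c) ≡ b ∨ c
  if≡∨ true  = refl
  if≡∨ false = refl

notᶜ : ∀ {A} {f : ⟦ A ⟧ → Bool} → Computable {A} {bool} f → Computable {A} {bool} (λ a → not (f a))
notᶜ {f = f} f-comp = ≗ᶜ (λ a → if≡not (f a)) (ifᶜ f-comp (constᶜ false) (constᶜ true))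
  where
  if≡not : ∀ b → (if b then false else true) ≡ not b
  if≡not true  = refl
  if≡not false = refl

anyᶜ : ∀ {A B} {p : ⟦ A ⟧ → ⟦ B ⟧ → Bool} {g : ⟦ A ⟧ → List ⟦ B ⟧} →
       Computable {A ⊗ B} {bool} (λ (a , b) → p a b) → Computable {A} {list B} g →
       Computable {A} {bool} (λ a → any (p a) (g a))
anyᶜ {p = p} p-comp g-comp =
  listrecᶜ {f = λ (a , bs) → any (p a) bs} (constᶜ false)
    (∨ᶜ (p-comp ∙ᶜ pairᶜ fstᶜ (fstᶜ ∙ᶜ sndᶜ)) (sndᶜ ∙ᶜ sndᶜ ∙ᶜ sndᶜ))
    (λ _ → refl) (λ _ _ _ → refl)
  ∙ᶜ pairᶜ idᶜ g-comp

allᶜ : ∀ {A B} {p : ⟦ A ⟧ → ⟦ B ⟧ → Bool} {g : ⟦ A ⟧ → List ⟦ B ⟧} →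
       Computable {A ⊗ B} {bool} (λ (a , b) → p a b) → Computable {A} {list B} g →
       Computable {A} {bool} (λ a → all (p a) (g a))
allᶜ {p = p} p-comp g-comp =
  listrecᶜ {f = λ (a , bs) → all (p a) bs} (constᶜ true)
    (∧ᶜ (p-comp ∙ᶜ pairᶜ fstᶜ (fstᶜ ∙ᶜ sndᶜ)) (sndᶜ ∙ᶜ sndᶜ ∙ᶜ sndᶜ))
    (λ _ → refl) (λ _ _ _ → refl)
  ∙ᶜ pairᶜ idᶜ g-comp

++ᶜ : ∀ {A B} {f g : ⟦ A ⟧ → List ⟦ B ⟧} → Computable {A} {list B} f → Computable {A} {list B} g →
      Computable {A} {list B} (λ a → f a ++ g a)
++ᶜ {f = f} {g} f-comp g-comp =
  listrecᶜ {f = λ (ys , xs) → xs ++ ys} idᶜ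
    (∷ᶜ (fstᶜ ∙ᶜ sndᶜ) (sndᶜ ∙ᶜ sndᶜ ∙ᶜ sndᶜ)) (λ _ → refl) (λ _ _ _ → refl)
  ∙ᶜ pairᶜ g-comp f-comp

[_]ᶜ : ∀ {A B} {f : ⟦ A ⟧ → ⟦ B ⟧} → Computable {A} {B} f → Computable {A} {list B} (λ a → [ f a ])
[ f-comp ]ᶜ = ∷ᶜ f-comp []ᶜ

concatMapᶜ : ∀ {A B C} {f : ⟦ A ⟧ → ⟦ B ⟧ → List ⟦ C ⟧} {g : ⟦ A ⟧ → List ⟦ B ⟧} →
             Computable {A ⊗ B} {list C} (λ (a , b) → f a b) → Computable {A} {list B} g →
             Computable {A} {list C} (λ a → concatMap (f a) (g a))
concatMapᶜ {f = f} f-comp g-comp =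
  listrecᶜ {f = λ (a , bs) → concatMap (f a) bs} []ᶜ
    (++ᶜ (f-comp ∙ᶜ pairᶜ fstᶜ (fstᶜ ∙ᶜ sndᶜ)) (sndᶜ ∙ᶜ sndᶜ ∙ᶜ sndᶜ))
    (λ _ → refl) (λ _ _ _ → refl)
  ∙ᶜ pairᶜ idᶜ g-comp

mapᶜ : ∀ {A B C} {f : ⟦ A ⟧ → ⟦ B ⟧ → ⟦ C ⟧} {g : ⟦ A ⟧ → List ⟦ B ⟧} →
       Computable {A ⊗ B} {C} (λ (a , b) → f a b) → Computable {A} {list B} g →
       Computable {A} {list C} (λ a → map (f a) (g a))
mapᶜ {f = f} f-comp g-comp =
  listrecᶜ {f = λ (a , bs) → map (f a) bs} []ᶜ
    (∷ᶜ (f-comp ∙ᶜ pairᶜ fstᶜ (fstᶜ ∙ᶜ sndᶜ)) (sndᶜ ∙ᶜ sndᶜ ∙ᶜ sndᶜ))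
    (λ _ → refl) (λ _ _ _ → refl)
  ∙ᶜ pairᶜ idᶜ g-comp

reverseᶜ : ∀ {A} → Computable {list A} {list A} reverse
reverseᶜ =
  -- `Ty` has no unit type; a recursion without parameters gets a dummy Boolean.
  listrecᶜ {A = bool} {f = λ (_ , xs) → reverse xs} []ᶜ (++ᶜ (sndᶜ ∙ᶜ sndᶜ ∙ᶜ sndᶜ) [ fstᶜ ∙ᶜ sndᶜ ]ᶜ)
    (λ _ → refl) (λ _ x xs → sym (unfold-reverse x xs))
  ∙ᶜ pairᶜ (constᶜ true) idᶜ

foldlᶜ : ∀ {A B C} {s : ⟦ A ⟧ → ⟦ C ⟧ → ⟦ B ⟧ → ⟦ C ⟧} {z : ⟦ A ⟧ → ⟦ C ⟧} {g : ⟦ A ⟧ → List ⟦ B ⟧} →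
         Computable {A ⊗ C ⊗ B} {C} (λ (a , c , b) → s a c b) →
         Computable {A} {C} z → Computable {A} {list B} g →
         Computable {A} {C} (λ a → foldl (s a) (z a) (g a))
foldlᶜ {s = s} {z} {g} s-comp z-comp g-comp =
  ≗ᶜ (λ a → reverse-foldr (flip (s a)) (z a) (g a))
    (foldrᶜ {s = λ a b c → s a c b} (s-comp ∙ᶜ pairᶜ fstᶜ (pairᶜ (sndᶜ ∙ᶜ sndᶜ) (fstᶜ ∙ᶜ sndᶜ)))
      z-comp (reverseᶜ ∙ᶜ g-comp))

lengthᶜ : ∀ {A} → Computable {list A} {nat} length
lengthᶜ =
  listrecᶜ {A = bool} {f = λ (_ , xs) → length xs} zeroᶜ (sucᶜ ∙ᶜ sndᶜ ∙ᶜ sndᶜ ∙ᶜ sndᶜ) (λ _ → refl) (λ _ _ _ → refl)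
  ∙ᶜ pairᶜ (constᶜ true) idᶜ

take1ᶜ : ∀ {A} → Computable {list A} {list A} (take 1)
take1ᶜ =
  listrecᶜ {A = bool} {f = λ (_ , xs) → take 1 xs} []ᶜ [ fstᶜ ∙ᶜ sndᶜ ]ᶜ (λ _ → refl) (λ _ _ _ → refl)
  ∙ᶜ pairᶜ (constᶜ true) idᶜ

tailᶜ : ∀ {A} → Computable {list A} {list A} (drop 1)
tailᶜ =
  listrecᶜ {A = bool} {f = λ (_ , xs) → drop 1 xs} []ᶜ (fstᶜ ∙ᶜ sndᶜ ∙ᶜ sndᶜ) (λ _ → refl) (λ _ _ _ → refl)
  ∙ᶜ pairᶜ (constᶜ true) idᶜ

dropᶜ : ∀ {A} → Computable {list A ⊗ nat} {list A} (λ (xs , n) → drop n xs)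
dropᶜ = natrecᶜ {f = λ (xs , n) → drop n xs} idᶜ (tailᶜ ∙ᶜ sndᶜ ∙ᶜ sndᶜ) (λ _ → refl)
  (λ xs n → trans (drop-drop n 1 xs) (cong (λ k → drop k xs) (+-comm n 1)))

downFromᶜ : Computable {nat} {list nat} downFrom
downFromᶜ =
  natrecᶜ {A = bool} {f = λ (_ , n) → downFrom n} []ᶜ (∷ᶜ (fstᶜ ∙ᶜ sndᶜ) (sndᶜ ∙ᶜ sndᶜ))
    (λ _ → refl) (λ _ _ → refl)
  ∙ᶜ pairᶜ (constᶜ true) idᶜ

-- Evaluation with a finite part of the oracle

iterateℕ : ∀ {B : Set} → List B → (ℕ → B → List B) → ℕ → List B
iterateℕ z s zero    = z
iterateℕ z s (suc n) = concatMap (s n) (iterateℕ z s n)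

iterateList : ∀ {B C : Set} → List C → (B → List B → C → List C) → List B → List C
iterateList z s []       = z
iterateList z s (b ∷ bs) = concatMap (s b bs) (iterateList z s bs)

-- Below `n` the test demands the value `false`, not merely the absence of `true`: an evaluation
-- without a result so far must block the answer, as it may still yield `true` on a longer oracle
-- part.
isLeast : (ℕ → List Bool) → ℕ → Bool
isLeast p n = any (λ b → b) (p n) ∧ all (λ m → any not (p m)) (downFrom n)

-- A list with at most one element: the output of the program if all queries are
-- answered by w and all minimizations stop below the length of w.
approx : ∀ {A B} → Program A B → Str → ⟦ A ⟧ → List ⟦ B ⟧
approx idn           w a        = [ a ]
approx (g ∙ f)       w a        = concatMap (approx g w) (approx f w a)
approx fst           w (a , b)  = [ a ]
approx snd           w (a , b)  = [ b ]
approx (pair f g)    w a        = concatMap (λ b → map (λ c → b , c) (approx g w a)) (approx f w a)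
approx (const b)     w a        = [ b ]
approx (ifte t f g)  w a        = concatMap (λ b → if b then approx f w a else approx g w a) (approx t w a)
approx zer           w a        = [ 0 ]
approx succ          w n        = [ suc n ]
approx (natrec z s)  w (a , n)  = iterateℕ (approx z w a) (λ n b → approx s w (a , n , b)) n
approx nil           w a        = [ [] ]
approx cons          w (a , as) = [ a ∷ as ]
approx (listrec z s) w (a , bs) = iterateList (approx z w a) (λ b bs c → approx s w (a , b , bs , c)) bs
approx (minimize f)  w a        =
  concatMap (λ n → if isLeast (λ m → approx f w (a , m)) n then [ n ] else []) (downFrom (length w))
approx query         w n        = take 1 (drop n w)

-- The recursion over `f` takes place in the metalanguage: each `f` receives its own evaluator,
-- whose data are the oracle part and the input.
approxᶜ : ∀ {A B} (f : Program A B) → Computable {str ⊗ A} {list B} (λ (w , a) → approx f w a)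
approxᶜ idn           = [ sndᶜ ]ᶜ
approxᶜ (g ∙ f)       = concatMapᶜ (approxᶜ g ∙ᶜ pairᶜ (fstᶜ ∙ᶜ fstᶜ) sndᶜ) (approxᶜ f)
approxᶜ fst           = [ fstᶜ ∙ᶜ sndᶜ ]ᶜ
approxᶜ snd           = [ sndᶜ ∙ᶜ sndᶜ ]ᶜ
approxᶜ (pair f g)    =
  concatMapᶜ (mapᶜ (pairᶜ (sndᶜ ∙ᶜ fstᶜ) sndᶜ) (approxᶜ g ∙ᶜ fstᶜ)) (approxᶜ f)
approxᶜ (const b)     = [ constᶜ b ]ᶜ
approxᶜ (ifte t f g)  = concatMapᶜ (ifᶜ sndᶜ (approxᶜ f ∙ᶜ fstᶜ) (approxᶜ g ∙ᶜ fstᶜ)) (approxᶜ t)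
approxᶜ zer           = [ zeroᶜ ]ᶜ
approxᶜ succ          = [ sucᶜ ∙ᶜ sndᶜ ]ᶜ
approxᶜ (natrec z s)  =
  natrecᶜ {f = λ ((w , a) , n) → approx (natrec z s) w (a , n)} (approxᶜ z)
    (concatMapᶜ
      (approxᶜ s ∙ᶜ pairᶜ (fstᶜ ∙ᶜ fstᶜ ∙ᶜ fstᶜ)
        (pairᶜ (sndᶜ ∙ᶜ fstᶜ ∙ᶜ fstᶜ) (pairᶜ (fstᶜ ∙ᶜ sndᶜ ∙ᶜ fstᶜ) sndᶜ)))
      (sndᶜ ∙ᶜ sndᶜ))
    (λ _ → refl) (λ _ _ → refl)
  ∙ᶜ pairᶜ (pairᶜ fstᶜ (fstᶜ ∙ᶜ sndᶜ)) (sndᶜ ∙ᶜ sndᶜ)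
approxᶜ nil           = [ []ᶜ ]ᶜ
approxᶜ cons          = [ ∷ᶜ (fstᶜ ∙ᶜ sndᶜ) (sndᶜ ∙ᶜ sndᶜ) ]ᶜ
approxᶜ (listrec z s) =
  listrecᶜ {f = λ ((w , a) , bs) → approx (listrec z s) w (a , bs)} (approxᶜ z)
    (concatMapᶜ
      (approxᶜ s ∙ᶜ pairᶜ (fstᶜ ∙ᶜ fstᶜ ∙ᶜ fstᶜ)
        (pairᶜ (sndᶜ ∙ᶜ fstᶜ ∙ᶜ fstᶜ)
          (pairᶜ (fstᶜ ∙ᶜ sndᶜ ∙ᶜ fstᶜ) (pairᶜ (fstᶜ ∙ᶜ sndᶜ ∙ᶜ sndᶜ ∙ᶜ fstᶜ) sndᶜ))))
      (sndᶜ ∙ᶜ sndᶜ ∙ᶜ sndᶜ))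
    (λ _ → refl) (λ _ _ _ → refl)
  ∙ᶜ pairᶜ (pairᶜ fstᶜ (fstᶜ ∙ᶜ sndᶜ)) (sndᶜ ∙ᶜ sndᶜ)
approxᶜ (minimize f)  =
  concatMapᶜ
    (ifᶜ
      (∧ᶜ (anyᶜ sndᶜ (approxᶜ f ∙ᶜ pairᶜ (fstᶜ ∙ᶜ fstᶜ) (pairᶜ (sndᶜ ∙ᶜ fstᶜ) sndᶜ)))
        (allᶜ
          (anyᶜ (notᶜ sndᶜ)
            (approxᶜ f ∙ᶜ pairᶜ (fstᶜ ∙ᶜ fstᶜ ∙ᶜ fstᶜ) (pairᶜ (sndᶜ ∙ᶜ fstᶜ ∙ᶜ fstᶜ) sndᶜ)))
          (downFromᶜ ∙ᶜ sndᶜ)))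
      [ sndᶜ ]ᶜ []ᶜ)
    (downFromᶜ ∙ᶜ lengthᶜ ∙ᶜ fstᶜ)
approxᶜ query         = take1ᶜ ∙ᶜ dropᶜ

-- Soundness, monotonicity and completeness of the finite evaluation

concatMap⁺ : ∀ {A B : Set} {f : A → List B} {x xs y} → x ∈ xs → y ∈ f x → y ∈ concatMap f xs
concatMap⁺ {f = f} x∈xs y∈fx = ∈-concatMap⁺ f (lose x∈xs y∈fx)

concatMap⁻ : ∀ {A B : Set} {f : A → List B} xs {y} → y ∈ concatMap f xs → ∃[ x ] x ∈ xs × y ∈ f x
concatMap⁻ {f = f} xs y∈ = find (∈-concatMap⁻ f {xs = xs} y∈)

∧-true⁻ : ∀ {a b} → a ∧ b ≡ true → a ≡ true × b ≡ true
∧-true⁻ {true} {true} _ = refl , refl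

any⁺ : ∀ {A : Set} {p : A → Bool} {x xs} → x ∈ xs → p x ≡ true → any p xs ≡ true
any⁺ {p = p} (here refl) px rewrite px = refl
any⁺ {p = p} {xs = y ∷ _} (there x∈xs) px rewrite any⁺ {p = p} x∈xs px = ∨-zeroʳ (p y)

any⁻ : ∀ {A : Set} {p : A → Bool} xs → any p xs ≡ true → ∃[ x ] x ∈ xs × p x ≡ true
any⁻ {p = p} (x ∷ xs) eq with p x in px
... | true  = x , here refl , px
... | false with y , y∈ , py ← any⁻ xs eq = y , there y∈ , py

all⁺ : ∀ {A : Set} {p : A → Bool} xs → (∀ {x} → x ∈ xs → p x ≡ true) → all p xs ≡ true
all⁺ []       h = refl
all⁺ (x ∷ xs) h rewrite h (here refl) = all⁺ xs (h ∘ there)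

all⁻ : ∀ {A : Set} {p : A → Bool} {x xs} → all p xs ≡ true → x ∈ xs → p x ≡ true
all⁻ eq (here refl)  = proj₁ (∧-true⁻ eq)
all⁻ eq (there x∈xs) = all⁻ (proj₂ (∧-true⁻ eq)) x∈xs

isLeast⁺ : ∀ {p n} → true ∈ p n → (∀ {m} → m < n → false ∈ p m) → isLeast p n ≡ true
isLeast⁺ {p} {n} true∈ false∈ =
  cong₂ _∧_ (any⁺ true∈ refl) (all⁺ (downFrom n) λ m∈ → any⁺ (false∈ (∈-downFrom⁻ m∈)) refl)

isLeast⁻ : ∀ {p} n → isLeast p n ≡ true → true ∈ p n × (∀ {m} → m < n → false ∈ p m)
isLeast⁻ {p} n least with is-true , below ← ∧-true⁻ {any (λ b → b) (p n)} least =
  true-member , λ m<n → false-member (all⁻ below (∈-downFrom⁺ m<n))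
  where
  true-member : true ∈ p n
  true-member with true , true∈ , _ ← any⁻ {p = λ b → b} (p n) is-true = true∈
  false-member : ∀ {bs} → any not bs ≡ true → false ∈ bs
  false-member {bs} eq with false , false∈ , _ ← any⁻ {p = not} bs eq = false∈

if-singleton⁺ : ∀ {A : Set} {b} {x : A} → b ≡ true → x ∈ (if b then [ x ] else [])
if-singleton⁺ refl = here refl

if-singleton⁻ : ∀ {A : Set} {b} {x y : A} → y ∈ (if b then [ x ] else []) → b ≡ true × y ≡ x
if-singleton⁻ {b = true} (here y≡x) = refl , y≡x

Extends-++⁻ : ∀ {X} w {e} → X Extends (w ++ e) → X Extends w
Extends-++⁻ []      eq = refl
Extends-++⁻ (b ∷ w) eq = cong₂ _∷_ (∷-injectiveˡ eq) (Extends-++⁻ w (∷-injectiveʳ eq))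

Extends-applyUpTo : ∀ X n → X Extends applyUpTo X n
Extends-applyUpTo X n = cong (applyUpTo X) (length-applyUpTo X n)

take1-drop-Extends : ∀ {X b} n w → X Extends w → b ∈ take 1 (drop n w) → X n ≡ b
take1-drop-Extends zero    (_ ∷ w) eq (here refl) = ∷-injectiveˡ eq
take1-drop-Extends (suc n) (_ ∷ w) eq b∈          = take1-drop-Extends n w (∷-injectiveʳ eq) b∈

take1-drop-++ : ∀ {A : Set} {b : A} n w {e} → b ∈ take 1 (drop n w) → b ∈ take 1 (drop n (w ++ e))
take1-drop-++ zero    (_ ∷ w) (here refl) = here refl
take1-drop-++ (suc n) (_ ∷ w) b∈          = take1-drop-++ n w b∈

take1-drop-applyUpTo : ∀ {A : Set} (X : ℕ → A) {n k} → n < k → X n ∈ take 1 (drop n (applyUpTo X k))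
take1-drop-applyUpTo X {zero}  (s≤s n<k) = here refl
take1-drop-applyUpTo X {suc n} (s≤s n<k) = take1-drop-applyUpTo (X ∘ suc) n<k

-- A query beyond the end of `w` yields the empty list, so a result depends only on bits that `X`
-- shares with `w`.
approx-sound : ∀ {A B} (f : Program A B) {X w a b} → X Extends w → b ∈ approx f w a → X ⊢ f ⟨ a ⟩⇓ b
approx-sound idn ext (here refl) = idn⇓
approx-sound (g ∙ f) {w = w} {a} ext c∈ with b , b∈ , c∈ ← concatMap⁻ (approx f w a) c∈ =
  ∙⇓ (approx-sound f ext b∈) (approx-sound g ext c∈)
approx-sound fst ext (here refl) = fst⇓
approx-sound snd ext (here refl) = snd⇓
approx-sound (pair f g) {w = w} {a} ext bc∈
  with b , b∈ , c∈ ← concatMap⁻ (approx f w a) bc∈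
  with c , c∈ , refl ← ∈-map⁻ _ c∈ =
  pair⇓ (approx-sound f ext b∈) (approx-sound g ext c∈)
approx-sound (const b) ext (here refl) = const⇓
approx-sound (ifte t f g) {w = w} {a} ext b∈ with concatMap⁻ (approx t w a) b∈
... | true  , t∈ , b∈ = ifte⇓₁ (approx-sound t ext t∈) (approx-sound f ext b∈)
... | false , t∈ , b∈ = ifte⇓₂ (approx-sound t ext t∈) (approx-sound g ext b∈)
approx-sound zer ext (here refl) = zer⇓
approx-sound succ ext (here refl) = succ⇓
approx-sound (natrec z s) {X} {w} {a , n} ext = run n
  where
  run : ∀ n {b} → b ∈ approx (natrec z s) w (a , n) → X ⊢ natrec z s ⟨ a , n ⟩⇓ b
  run zero    b∈ = natrec⇓₀ (approx-sound z ext b∈)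
  run (suc n) b∈ with c , c∈ , b∈ ← concatMap⁻ (approx (natrec z s) w (a , n)) b∈ =
    natrec⇓₁ (run n c∈) (approx-sound s ext b∈)
approx-sound nil ext (here refl) = nil⇓
approx-sound cons ext (here refl) = cons⇓
approx-sound (listrec z s) {X} {w} {a , bs} ext = run bs
  where
  run : ∀ bs {b} → b ∈ approx (listrec z s) w (a , bs) → X ⊢ listrec z s ⟨ a , bs ⟩⇓ b
  run []       b∈ = listrec⇓₀ (approx-sound z ext b∈)
  run (x ∷ bs) b∈ with c , c∈ , b∈ ← concatMap⁻ (approx (listrec z s) w (a , bs)) b∈ =
    listrec⇓₁ (run bs c∈) (approx-sound s ext b∈)
approx-sound (minimize f) {w = w} {a} ext n∈
  with n , _ , n∈ ← concatMap⁻ (downFrom (length w)) n∈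
  with least , refl ← if-singleton⁻ n∈
  with true∈ , false∈ ← isLeast⁻ n least =
  minimize⇓ (λ m m<n → approx-sound f ext (false∈ m<n)) (approx-sound f ext true∈)
approx-sound query {w = w} {n} ext b∈ with refl ← take1-drop-Extends n w ext b∈ = query⇓

-- A longer oracle part keeps all answers already given and only widens the range of the
-- minimizations. Compactness relies on this persistence.
approx-mono : ∀ {A B} (f : Program A B) w {e a b} → b ∈ approx f w a → b ∈ approx f (w ++ e) a
approx-mono idn w b∈ = b∈
approx-mono (g ∙ f) w {a = a} c∈ with b , b∈ , c∈ ← concatMap⁻ (approx f w a) c∈ =
  concatMap⁺ (approx-mono f w b∈) (approx-mono g w c∈)
approx-mono fst w b∈ = b∈
approx-mono snd w b∈ = b∈
approx-mono (pair f g) w {a = a} bc∈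
  with b , b∈ , c∈ ← concatMap⁻ (approx f w a) bc∈
  with c , c∈ , refl ← ∈-map⁻ _ c∈ =
  concatMap⁺ (approx-mono f w b∈) (∈-map⁺ _ (approx-mono g w c∈))
approx-mono (const b) w b∈ = b∈
approx-mono (ifte t f g) w {a = a} b∈ with concatMap⁻ (approx t w a) b∈
... | true  , t∈ , b∈ = concatMap⁺ (approx-mono t w t∈) (approx-mono f w b∈)
... | false , t∈ , b∈ = concatMap⁺ (approx-mono t w t∈) (approx-mono g w b∈)
approx-mono zer w b∈ = b∈
approx-mono succ w b∈ = b∈
approx-mono (natrec z s) w {e} {a , n} = run n
  where
  run : ∀ n {b} → b ∈ approx (natrec z s) w (a , n) → b ∈ approx (natrec z s) (w ++ e) (a , n)
  run zero    b∈ = approx-mono z w b∈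
  run (suc n) b∈ with c , c∈ , b∈ ← concatMap⁻ (approx (natrec z s) w (a , n)) b∈ =
    concatMap⁺ (run n c∈) (approx-mono s w b∈)
approx-mono nil w b∈ = b∈
approx-mono cons w b∈ = b∈
approx-mono (listrec z s) w {e} {a , bs} = run bs
  where
  run : ∀ bs {b} → b ∈ approx (listrec z s) w (a , bs) → b ∈ approx (listrec z s) (w ++ e) (a , bs)
  run []       b∈ = approx-mono z w b∈
  run (x ∷ bs) b∈ with c , c∈ , b∈ ← concatMap⁻ (approx (listrec z s) w (a , bs)) b∈ =
    concatMap⁺ (run bs c∈) (approx-mono s w b∈)
approx-mono (minimize f) w {e} n∈
  with n , n∈w , n∈ ← concatMap⁻ (downFrom (length w)) n∈
  with least , refl ← if-singleton⁻ n∈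
  with true∈ , false∈ ← isLeast⁻ n least =
  concatMap⁺
    (∈-downFrom⁺ (<-≤-trans (∈-downFrom⁻ n∈w) (≤-trans (m≤m+n _ _) (≤-reflexive (sym (length-++ w))))))
    (if-singleton⁺ (isLeast⁺ (approx-mono f w true∈) (approx-mono f w ∘ false∈)))
approx-mono query w {a = n} b∈ = take1-drop-++ n w b∈

Eventually : (ℕ → Set) → Set
Eventually P = ∃[ n₀ ] ∀ {n} → n₀ ≤ n → P n

eventually-always : ∀ {P : ℕ → Set} → (∀ n → P n) → Eventually P
eventually-always p = 0 , λ {n} _ → p n

eventually-× : ∀ {P Q R : ℕ → Set} → (∀ {n} → P n → Q n → R n) → Eventually P → Eventually Q → Eventually R
eventually-× f (m , p) (n , q) = m ⊔ n , λ m⊔n≤ → f (p (m⊔n≤o⇒m≤o m n m⊔n≤)) (q (m⊔n≤o⇒n≤o m n m⊔n≤))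

-- Finitely many thresholds have a common bound. This serves the minimization rule, which has one
-- premise for each `m < n`.
eventually-< : ∀ {P : ℕ → ℕ → Set} n → (∀ m → m < n → Eventually (P m)) →
               Eventually (λ k → ∀ {m} → m < n → P m k)
eventually-< zero    p = eventually-always λ _ ()
eventually-< {P} (suc n) p =
  eventually-× combine (eventually-< n λ m m<n → p m (m<n⇒m<1+n m<n)) (p n ≤-refl)
  where
  combine : ∀ {k} → (∀ {m} → m < n → P m k) → P n k → ∀ {m} → m < suc n → P m k
  combine below at {m} m<1+n with m<1+n⇒m<n∨m≡n m<1+n
  ... | inj₁ m<n  = below m<n
  ... | inj₂ refl = at

-- A halting computation makes finitely many queries and minimizations; a prefix of `X` that is
-- longer than every queried position and every minimum found suffices.
approx-complete : ∀ {X A B} {f : Program A B} {a b} → X ⊢ f ⟨ a ⟩⇓ b →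
                  Eventually λ n → b ∈ approx f (applyUpTo X n) a
approx-complete idn⇓ = eventually-always λ _ → here refl
approx-complete (∙⇓ p q) = eventually-× concatMap⁺ (approx-complete p) (approx-complete q)
approx-complete fst⇓ = eventually-always λ _ → here refl
approx-complete snd⇓ = eventually-always λ _ → here refl
approx-complete (pair⇓ p q) =
  eventually-× (λ b∈ c∈ → concatMap⁺ b∈ (∈-map⁺ _ c∈)) (approx-complete p) (approx-complete q)
approx-complete const⇓ = eventually-always λ _ → here refl
approx-complete (ifte⇓₁ p q) = eventually-× concatMap⁺ (approx-complete p) (approx-complete q)
approx-complete (ifte⇓₂ p q) = eventually-× concatMap⁺ (approx-complete p) (approx-complete q)
approx-complete zer⇓ = eventually-always λ _ → here refl
approx-complete succ⇓ = eventually-always λ _ → here refl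
approx-complete (natrec⇓₀ p) = approx-complete p
approx-complete (natrec⇓₁ p q) = eventually-× concatMap⁺ (approx-complete p) (approx-complete q)
approx-complete nil⇓ = eventually-always λ _ → here refl
approx-complete cons⇓ = eventually-always λ _ → here refl
approx-complete (listrec⇓₀ p) = approx-complete p
approx-complete (listrec⇓₁ p q) = eventually-× concatMap⁺ (approx-complete p) (approx-complete q)
approx-complete {X} (minimize⇓ {n = n} p q) =
  eventually-×
    (λ {k} n<k least → concatMap⁺ (∈-downFrom⁺ (subst (n <_) (sym (length-applyUpTo X k)) n<k)) (if-singleton⁺ least))
    (suc n , λ n<k → n<k)
    (eventually-× isLeast⁺ (approx-complete q)
      (eventually-< n λ m m<n → approx-complete (p m m<n)))
approx-complete {X} (query⇓ {n}) = suc n , take1-drop-applyUpTo X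

-- Binary strings

prepend : List Str → List Str
prepend []       = []
prepend (w ∷ ws) = (false ∷ w) ∷ (true ∷ w) ∷ prepend ws

strings : ℕ → List Str
strings zero    = [ [] ]
strings (suc n) = prepend (strings n)

stringsBelow : ℕ → List Str
stringsBelow zero    = []
stringsBelow (suc n) = strings n ++ stringsBelow n

∈-prepend⁺ : ∀ {b w ws} → w ∈ ws → b ∷ w ∈ prepend ws
∈-prepend⁺ {false} (here refl) = here refl
∈-prepend⁺ {true}  (here refl) = there (here refl)
∈-prepend⁺         (there w∈)  = there (there (∈-prepend⁺ w∈))

∈-prepend⁻ : ∀ {w} ws → w ∈ prepend ws → ∃[ b ] ∃[ v ] w ≡ b ∷ v × v ∈ ws
∈-prepend⁻ (_ ∷ _)  (here refl)         = false , _ , refl , here refl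
∈-prepend⁻ (_ ∷ _)  (there (here refl)) = true , _ , refl , here refl
∈-prepend⁻ (_ ∷ ws) (there (there w∈)) with b , v , eq , v∈ ← ∈-prepend⁻ ws w∈ = b , v , eq , there v∈

∈-strings⁺ : ∀ w → w ∈ strings (length w)
∈-strings⁺ []      = here refl
∈-strings⁺ (b ∷ w) = ∈-prepend⁺ (∈-strings⁺ w)

∈-strings⁻ : ∀ n {w} → w ∈ strings n → length w ≡ n
∈-strings⁻ zero    (here refl) = refl
∈-strings⁻ (suc n) w∈ with _ , _ , refl , v∈ ← ∈-prepend⁻ (strings n) w∈ = cong suc (∈-strings⁻ n v∈)

∈-stringsBelow⁺ : ∀ {n} w → length w < n → w ∈ stringsBelow n
∈-stringsBelow⁺ {suc n} w |w|<1+n with m<1+n⇒m<n∨m≡n |w|<1+n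
... | inj₁ |w|<n = ∈-++⁺ʳ (strings n) (∈-stringsBelow⁺ w |w|<n)
... | inj₂ refl  = ∈-++⁺ˡ (∈-strings⁺ w)

∈-stringsBelow⁻ : ∀ n {w} → w ∈ stringsBelow n → length w < n
∈-stringsBelow⁻ (suc n) w∈ with ∈-++⁻ (strings n) w∈
... | inj₁ w∈ = ≤-reflexive (cong suc (∈-strings⁻ n w∈))
... | inj₂ w∈ = m<n⇒m<1+n (∈-stringsBelow⁻ n w∈)

prepend-unique : ∀ {ws} → Unique ws → Unique (prepend ws)
prepend-unique []                  = []
prepend-unique {w ∷ ws} (w≢ ∷ ws!) = ((λ ()) ∷ apart) ∷ apart ∷ prepend-unique ws!
  where
  apart : ∀ {b} → All ((b ∷ w) ≢_) (prepend ws)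
  apart = ¬Any⇒All¬ (prepend ws) λ bw∈ → case ∈-prepend⁻ ws bw∈ of λ
    { (_ , _ , refl , w∈) → All¬⇒¬Any w≢ w∈ }

strings-unique : ∀ n → Unique (strings n)
strings-unique zero    = [] ∷ []
strings-unique (suc n) = prepend-unique (strings-unique n)

length-prepend : ∀ ws → length (prepend ws) ≡ length ws + length ws
length-prepend []       = refl
length-prepend (w ∷ ws) = cong suc (trans (cong suc (length-prepend ws)) (sym (+-suc _ _)))

-- That is, 1 + (2^n - 1) = 2^n. It compares the programs shorter than `n`, which bound chains, with
-- the colours of length `n`.
length-stringsBelow : ∀ n → suc (length (stringsBelow n)) ≡ length (strings n)
length-stringsBelow zero    = refl
length-stringsBelow (suc n) = begin
  suc (length (strings n ++ stringsBelow n))           ≡⟨ cong suc (length-++ (strings n)) ⟩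
  suc (length (strings n) + length (stringsBelow n))   ≡⟨ +-suc _ _ ⟨
  length (strings n) + suc (length (stringsBelow n))   ≡⟨ cong (length (strings n) +_) (length-stringsBelow n) ⟩
  length (strings n) + length (strings n)              ≡⟨ length-prepend (strings n) ⟨
  length (prepend (strings n))                         ∎
  where open ≡-Reasoning

-- The prefix order and its decision procedure

≼-refl : ∀ {w} → w IsPrefixOf w
≼-refl {[]}    = []
≼-refl {_ ∷ _} = refl ∷ ≼-refl

≼-trans : ∀ {u v w} → u IsPrefixOf v → v IsPrefixOf w → u IsPrefixOf w
≼-trans = Prefix.trans trans

≼-antisym : ∀ {u v} → u IsPrefixOf v → v IsPrefixOf u → u ≡ v
≼-antisym u≼v v≼u = Pointwise-≡⇒≡ (Prefix.antisym (λ eq _ → eq) u≼v v≼u)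

≼⇒++ : ∀ {u v} → u IsPrefixOf v → ∃[ e ] v ≡ u ++ e
≼⇒++ []           = _ , refl
≼⇒++ (refl ∷ u≼v) with e , refl ← ≼⇒++ u≼v = e , refl

Comparable : Str → Str → Set
Comparable u v = u IsPrefixOf v ⊎ v IsPrefixOf u

prefixes-comparable : ∀ {u v w} → u IsPrefixOf w → v IsPrefixOf w → Comparable u v
prefixes-comparable []          _           = inj₁ []
prefixes-comparable (_ ∷ _)     []          = inj₂ []
prefixes-comparable (refl ∷ u≼) (refl ∷ v≼) with prefixes-comparable u≼ v≼
... | inj₁ u≼v = inj₁ (refl ∷ u≼v)
... | inj₂ v≼u = inj₂ (refl ∷ v≼u)

Extends-≼ : ∀ {X u v} → X Extends v → u IsPrefixOf v → X Extends u
Extends-≼ {u = u} ext u≼v with _ , refl ← ≼⇒++ u≼v = Extends-++⁻ u ext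

applyUpTo-+ : ∀ {A : Set} (X : ℕ → A) m n → applyUpTo X (m + n) ≡ applyUpTo X m ++ applyUpTo (X ∘ (m +_)) n
applyUpTo-+ X zero    n = refl
applyUpTo-+ X (suc m) n = cong (X 0 ∷_) (applyUpTo-+ (X ∘ suc) m n)

Extends⇒≼ : ∀ {X w n} → X Extends w → length w ≤ n → w IsPrefixOf applyUpTo X n
Extends⇒≼ {X} {w} ext |w|≤n with k , refl ← m≤n⇒∃[o]m+o≡n |w|≤n =
  subst (w IsPrefixOf_)
    (sym (trans (applyUpTo-+ X (length w) k) (cong (_++ applyUpTo (X ∘ (length w +_)) k) ext)))
    (≼-refl ++ᵖ _)

Extends⇒Comparable : ∀ {X u v} → X Extends u → X Extends v → Comparable u v
Extends⇒Comparable {u = u} {v} ext-u ext-v =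
  prefixes-comparable (Extends⇒≼ ext-u (m≤m⊔n (length u) (length v))) (Extends⇒≼ ext-v (m≤n⊔m (length u) (length v)))

infixr 5 _⌢_

_⌢_ : Str → Sequence → Sequence
([] ⌢ W)            = W
((b ∷ w) ⌢ W) zero    = b
((b ∷ w) ⌢ W) (suc n) = (w ⌢ W) n

applyUpTo-⌢ : ∀ w {W} n → applyUpTo (w ⌢ W) (length w + n) ≡ w ++ applyUpTo W n
applyUpTo-⌢ []      n = refl
applyUpTo-⌢ (b ∷ w) n = cong (b ∷_) (applyUpTo-⌢ w n)

⌢-Extends : ∀ w {W} → (w ⌢ W) Extends w
⌢-Extends []      = refl
⌢-Extends (b ∷ w) = cong (b ∷_) (⌢-Extends w)

sameBit : Bool → Bool → Bool
sameBit b c = if b then c else not c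

-- Recursion on two strings at once is not an instance of `listrec`. The comparison therefore
-- consumes `v` bit by bit while folding over `u`, and the empty list records a mismatch for good.
matchHead : Bool → Str → List Str
matchHead b []      = []
matchHead b (c ∷ w) = if sameBit b c then [ w ] else []

-- A left fold, so that it is a list recursion on the reversal of u.
isPrefix : Str → Str → Bool
isPrefix u v = any (λ _ → true) (foldl (λ ws b → concatMap (matchHead b) ws) [ v ] u)

foldl-matchHead-[] : ∀ u → foldl (λ ws b → concatMap (matchHead b) ws) [] u ≡ []
foldl-matchHead-[] []      = refl
foldl-matchHead-[] (_ ∷ u) = foldl-matchHead-[] u

isPrefix⁺ : ∀ {u v} → u IsPrefixOf v → isPrefix u v ≡ true
isPrefix⁺ []                   = refl
isPrefix⁺ {true ∷ _} (refl ∷ u≼v)  = isPrefix⁺ u≼v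
isPrefix⁺ {false ∷ _} (refl ∷ u≼v) = isPrefix⁺ u≼v

isPrefix⁻ : ∀ u v → isPrefix u v ≡ true → u IsPrefixOf v
isPrefix⁻ [] v eq = []
isPrefix⁻ (b ∷ u) [] eq rewrite foldl-matchHead-[] u = contradiction eq λ ()
isPrefix⁻ (true ∷ u) (true ∷ v) eq = refl ∷ isPrefix⁻ u v eq
isPrefix⁻ (true ∷ u) (false ∷ v) eq rewrite foldl-matchHead-[] u = contradiction eq λ ()
isPrefix⁻ (false ∷ u) (true ∷ v) eq rewrite foldl-matchHead-[] u = contradiction eq λ ()
isPrefix⁻ (false ∷ u) (false ∷ v) eq = refl ∷ isPrefix⁻ u v eq

equal : Str → Str → Bool
equal u v = isPrefix u v ∧ isPrefix v u

equal-refl : ∀ u → equal u u ≡ true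
equal-refl u = cong₂ _∧_ (isPrefix⁺ {u} ≼-refl) (isPrefix⁺ {u} ≼-refl)

equal⁻ : ∀ u v → equal u v ≡ true → u ≡ v
equal⁻ u v eq with u≼v , v≼u ← ∧-true⁻ {isPrefix u v} eq = ≼-antisym (isPrefix⁻ u v u≼v) (isPrefix⁻ v u v≼u)

comparable : Str → Str → Bool
comparable u v = isPrefix u v ∨ isPrefix v u

comparable⁺ : ∀ {u v} → Comparable u v → comparable u v ≡ true
comparable⁺ (inj₁ u≼v) rewrite isPrefix⁺ u≼v = refl
comparable⁺ {u} {v} (inj₂ v≼u) rewrite isPrefix⁺ v≼u = ∨-zeroʳ (isPrefix u v)

comparable⁻ : ∀ u v → comparable u v ≡ true → Comparable u v
comparable⁻ u v eq with isPrefix u v in u≼v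
... | true  = inj₁ (isPrefix⁻ u v u≼v)
... | false = inj₂ (isPrefix⁻ v u eq)

-- Compactness of the Cantor space

-- `P` is a uniform bar above `w`, in the sense of the fan theorem.
Secured : (Str → Set) → Str → Set
Secured P w = Eventually λ s → ∀ {e} → length e ≡ s → P (w ++ e)

secured-children : ∀ {P w} → Secured P (w ++ [ false ]) → Secured P (w ++ [ true ]) → Secured P w
secured-children {P} {w} (m , p) (n , q) = suc (m ⊔ n) , extend
  where
  extend : ∀ {s} → suc (m ⊔ n) ≤ s → ∀ {e} → length e ≡ s → P (w ++ e)
  extend (s≤s m⊔n≤) {false ∷ e} refl = subst P (++-assoc w _ e) (p (m⊔n≤o⇒m≤o m n m⊔n≤) refl)
  extend (s≤s m⊔n≤) {true ∷ e}  refl = subst P (++-assoc w _ e) (q (m⊔n≤o⇒n≤o m n m⊔n≤) refl)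

branch : (Str → Bool) → Str → Sequence
branch next w zero    = next w
branch next w (suc n) = branch next (w ++ [ next w ]) n

branch-invariant : ∀ {P : Str → Set} next → (∀ w → P w → P (w ++ [ next w ])) →
                   ∀ w n → P w → P (w ++ applyUpTo (branch next w) n)
branch-invariant {P} next step w zero    Pw = subst P (sym (++-identityʳ w)) Pw
branch-invariant {P} next step w (suc n) Pw =
  subst P (++-assoc w _ _) (branch-invariant next step (w ++ [ next w ]) n (step w Pw))

-- König's lemma by contradiction. By `secured-children` an unsecured node has an unsecured child,
-- so an unsecured `w` starts an infinite path of unsecured nodes. But `P` holds somewhere on this
-- path, and a node where `P` holds is secured with threshold 0.
compactness : ExcludedMiddle 0ℓ → ∀ {P} → (∀ w {e} → P w → P (w ++ e)) → ∀ w →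
              (∀ X → X Extends w → Eventually λ n → P (applyUpTo X n)) → Secured P w
compactness em {P} P-++ w covered with em {Secured P w}
... | yes secured  = secured
... | no ¬secured =
  let W = branch next w
      n , P-at = covered (w ⌢ W) (⌢-Extends w)
      -- The threshold `n` may be shorter than `w`; at length `length w + n` the prefix passes `w`
      -- and lies on the path.
      P-wW = subst P (applyUpTo-⌢ w n) (P-at (m≤n+m n (length w)))
  in ⊥-elim (branch-invariant next step w n ¬secured (0 , λ _ _ → P-++ (w ++ applyUpTo W n) P-wW))
  where
  -- At an unsecured `v` the chosen child is unsecured: if the false child is secured, the true one
  -- cannot be secured too.
  next : Str → Bool
  next v with em {Secured P (v ++ [ false ])}
  ... | yes _ = true
  ... | no  _ = false
  step : ∀ v → ¬ Secured P v → ¬ Secured P (v ++ [ next v ])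
  step v ¬secured with em {Secured P (v ++ [ false ])}
  ... | yes secured-false = λ secured-true → ¬secured (secured-children {P} {v} secured-false secured-true)
  ... | no ¬secured-false = ¬secured-false

-- First-fit colouring

firstWhere : (Str → Bool) → List Str → List Str
firstWhere p cs = foldr (λ c rest → if p c then [ c ] else rest) [] cs

-- A partial colouring is a list of pairs (string, colour).

coloured : List (Str × Str) → Str → Bool
coloured E y = any (λ (v , _) → equal v y) E

clashes : List (Str × Str) → Str → Str → Bool
clashes E y c = any (λ (v , d) → equal d c ∧ comparable v y) E

-- If no colour is free, `y` is silently dropped; `insert-covers` excludes this when chains are
-- short.
insert : List Str → List (Str × Str) → Str → List (Str × Str)
insert L E y = if coloured E y then E else map (y ,_) (firstWhere (λ c → not (clashes E y c)) L) ++ E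

coloured⁺ : ∀ {E y c} → (y , c) ∈ E → coloured E y ≡ true
coloured⁺ {y = y} yc∈ = any⁺ yc∈ (equal-refl y)

coloured⁻ : ∀ E y → coloured E y ≡ true → ∃[ c ] (y , c) ∈ E
coloured⁻ E y eq with (v , c) , vc∈ , v≡y ← any⁻ E eq with refl ← equal⁻ v y v≡y = c , vc∈

-- Colour `c` is blocked at `v`. The colouring is an arbitrary relation because the induction in
-- `firstFit-chain` passes to the restriction `S v c × c ≢ d`.
Near : (Str → Str → Set) → Str → Str → Set
Near S v c = ∃[ w ] S w c × Comparable w v

_HasColourIn_ : Str → List (Str × Str) → Str → Set
(v HasColourIn E) c = (v , c) ∈ E

clashes⁺ : ∀ {E y c} → Near (_HasColourIn E) y c → clashes E y c ≡ true
clashes⁺ {c = c} (w , wc∈ , w~y) = any⁺ wc∈ (cong₂ _∧_ (equal-refl c) (comparable⁺ w~y))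

clashes⁻ : ∀ E y c → clashes E y c ≡ true → Near (_HasColourIn E) y c
clashes⁻ E y c eq
  with (w , d) , wd∈ , both ← any⁻ E eq
  with d≡c , w~y ← ∧-true⁻ {equal d c} both
  with refl ← equal⁻ d c d≡c = w , wd∈ , comparable⁻ w y w~y

-- The inductive form matches the induction of `firstFit-chain`, which removes the first colour of
-- the list at each step.
data FirstFit (P : Str → Set) (c : Str) : List Str → Set where
  here  : ∀ {L} → FirstFit P c (c ∷ L)
  there : ∀ {d L} → P d → FirstFit P c L → FirstFit P c (d ∷ L)

firstFit-map : ∀ {P Q : Str → Set} {c L} → (∀ {d} → d ∈ L → P d → Q d) → FirstFit P c L → FirstFit Q c L
firstFit-map P⇒Q here         = here
firstFit-map P⇒Q (there p ff) = there (P⇒Q (here refl) p) (firstFit-map (P⇒Q ∘ there) ff)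

firstFit⇒∈ : ∀ {P c L} → FirstFit P c L → c ∈ L
firstFit⇒∈ here         = here refl
firstFit⇒∈ (there _ ff) = there (firstFit⇒∈ ff)

firstWhere-firstFit : ∀ {p c} L → c ∈ firstWhere p L → FirstFit (λ d → p d ≡ false) c L × p c ≡ true
firstWhere-firstFit {p} (d ∷ L) c∈ with p d in pd
firstWhere-firstFit {p} (d ∷ L) (here refl) | true = here , pd
... | false with ff , pc ← firstWhere-firstFit L c∈ = there pd ff , pc

firstWhere-exhaustive : ∀ {p} L → (∃[ c ] c ∈ firstWhere p L) ⊎ All (λ c → p c ≡ false) L
firstWhere-exhaustive     []      = inj₂ []
firstWhere-exhaustive {p} (c ∷ L) with p c in pc
... | true  = inj₁ (c , here refl)
... | false with firstWhere-exhaustive {p} L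
...   | inj₁ found = inj₁ found
...   | inj₂ none  = inj₂ (pc ∷ none)

∈-firstWhere-unique : ∀ {p c d} L → c ∈ firstWhere p L → d ∈ firstWhere p L → c ≡ d
∈-firstWhere-unique {p} (x ∷ L) c∈ d∈ with p x
∈-firstWhere-unique {p} (x ∷ L) (here refl) (here refl) | true = refl
... | false = ∈-firstWhere-unique L c∈ d∈

not-true⁻ : ∀ {b} → not b ≡ true → b ≡ false
not-true⁻ {false} _ = refl

not-false⁻ : ∀ {b} → not b ≡ false → b ≡ true
not-false⁻ {true} _ = refl

-- Prefixes of one string are pairwise comparable, so `below` already makes the members a chain. An
-- explicit `top` gives a single sequence extending all of them, and a place where a further element
-- can be attached.
record Chain (P : Str → Set) (n : ℕ) : Set where
  field
    top      : Str
    members  : List Str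
    below    : All (_IsPrefixOf top) members
    distinct : Unique members
    size     : length members ≡ n
    P-top    : P top
    P-all    : All P members

-- An element comparable to the top of a chain is comparable to the whole chain.
-- Since the top was not given the first colour d, first fit provides such an
-- element of colour d, which lengthens a chain avoiding d.
firstFit-chain : ∀ {S : Str → Str → Set} L → Unique L →
                 (∀ {v c} → S v c → FirstFit (Near S v) c L) →
                 (∀ {v c d} → S v c → S v d → c ≡ d) →
                 ∀ y → (∀ {c} → ¬ S y c) → All (Near S y) L →
                 Chain (λ v → v ≡ y ⊎ ∃[ c ] S v c) (suc (length L))
firstFit-chain [] _ _ _ y _ _ = record
  { top = y ; members = [ y ] ; below = ≼-refl ∷ [] ; distinct = [] ∷ []
  ; size = refl ; P-top = inj₁ refl ; P-all = inj₁ refl ∷ [] }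
firstFit-chain {S} (d ∷ L) (d≢ ∷ L!) S-fits S-single y y∉S (y-near ∷ y-nears)
  with firstFit-chain {λ v c → S v c × c ≢ d} L L! fits (λ (vc , _) (vc′ , _) → S-single vc vc′) y (y∉S ∘ proj₁)
         (All.tabulate λ c∈ → avoid c∈ (All.lookup y-nears c∈))
  where
  avoid : ∀ {v c} → c ∈ L → Near S v c → Near (λ v c → S v c × c ≢ d) v c
  avoid c∈ (w , wc , w~v) = w , (wc , λ { refl → All¬⇒¬Any d≢ c∈ }) , w~v
  fits : ∀ {v c} → S v c × c ≢ d → FirstFit (Near (λ v c → S v c × c ≢ d) v) c L
  fits (vc , c≢d) with S-fits vc
  ... | here       = contradiction refl c≢d
  ... | there _ ff = firstFit-map avoid ff
... | record { top = t ; members = K ; below = K≼t ; distinct = K! ; size = |K| ; P-top = t-origin ; P-all = K-origin }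
  with t-near t-origin
  where
  t-near : (t ≡ y ⊎ ∃[ c ] S t c × c ≢ d) → Near S t d
  t-near (inj₁ refl) = y-near
  t-near (inj₂ (c , tc , c≢d)) with S-fits tc
  ... | here         = contradiction refl c≢d
  ... | there near _ = near
... | w , wd , w~t = lengthen w~t
  where
  -- `w` has colour `d`, whereas a member of `K` is either the uncoloured `y` or has a colour other
  -- than `d`.
  w∉K : w ∉ K
  w∉K w∈K with All.lookup K-origin w∈K
  ... | inj₁ refl              = y∉S wd
  ... | inj₂ (c , wc , c≢d)    = c≢d (S-single wc wd)
  forget : ∀ {v} → (v ≡ y ⊎ ∃[ c ] S v c × c ≢ d) → (v ≡ y ⊎ ∃[ c ] S v c)
  forget (inj₁ v≡y)          = inj₁ v≡y
  forget (inj₂ (c , vc , _)) = inj₂ (c , vc)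
  lengthen : Comparable w t → Chain (λ v → v ≡ y ⊎ ∃[ c ] S v c) (suc (suc (length L)))
  lengthen (inj₁ w≼t) = record
    { top = t ; members = w ∷ K ; below = w≼t ∷ K≼t ; distinct = ¬Any⇒All¬ K w∉K ∷ K!
    ; size = cong suc |K| ; P-top = forget t-origin ; P-all = inj₂ (d , wd) ∷ All.map forget K-origin }
  lengthen (inj₂ t≼w) = record
    { top = w ; members = w ∷ K ; below = ≼-refl ∷ All.map (λ v≼t → ≼-trans v≼t t≼w) K≼t
    ; distinct = ¬Any⇒All¬ K w∉K ∷ K!
    ; size = cong suc |K| ; P-top = inj₂ (d , wd) ; P-all = inj₂ (d , wd) ∷ All.map forget K-origin }

-- `firstFit` speaks of the current `E` instead of the one at the time of insertion. In this form it
-- survives further insertions, since `Near` only grows with `E`, and `firstFit-chain` asks for no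
-- more.
record Valid (T : Str → Set) (L : List Str) (E : List (Str × Str)) : Set where
  field
    accepted : ∀ {v c} → (v , c) ∈ E → T v
    proper   : ∀ {v w c} → (v , c) ∈ E → (w , c) ∈ E → Comparable v w → v ≡ w
    single   : ∀ {v c d} → (v , c) ∈ E → (v , d) ∈ E → c ≡ d
    firstFit : ∀ {v c} → (v , c) ∈ E → FirstFit (Near (_HasColourIn E) v) c L

open Valid

insert-⊆ : ∀ L E y {vc} → vc ∈ E → vc ∈ insert L E y
insert-⊆ L E y vc∈ with coloured E y
... | true  = vc∈
... | false = ∈-++⁺ʳ _ vc∈

insert-valid : ∀ {T L E y} → T y → Valid T L E → Valid T L (insert L E y)
insert-valid {T} {L} {E} {y} Ty valid with coloured E y in uncoloured
... | true  = valid
... | false = record { accepted = accepted′ ; proper = proper′ ; single = single′ ; firstFit = firstFit′ }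
  where
  free = firstWhere (λ c → not (clashes E y c)) L
  E′ = map (y ,_) free ++ E
  split : ∀ {v c} → (v , c) ∈ E′ → (v ≡ y × c ∈ free) ⊎ (v , c) ∈ E
  split vc∈ with ∈-++⁻ (map (y ,_) free) vc∈
  ... | inj₂ vc∈E = inj₂ vc∈E
  ... | inj₁ vc∈new with c , c∈ , refl ← ∈-map⁻ _ vc∈new = inj₁ (refl , c∈)
  y∉E : ∀ {c} → (y , c) ∉ E
  y∉E yc∈ with () ← trans (sym uncoloured) (coloured⁺ yc∈)
  ¬near : ∀ {c} → c ∈ free → ¬ Near (_HasColourIn E) y c
  ¬near c∈ near with () ← trans (sym (clashes⁺ near)) (not-true⁻ (proj₂ (firstWhere-firstFit L c∈)))
  accepted′ : ∀ {v c} → (v , c) ∈ E′ → T v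
  accepted′ vc∈ with split vc∈
  ... | inj₁ (refl , _) = Ty
  ... | inj₂ vc∈E       = accepted valid vc∈E
  proper′ : ∀ {v w c} → (v , c) ∈ E′ → (w , c) ∈ E′ → Comparable v w → v ≡ w
  proper′ vc∈ wc∈ v~w with split vc∈ | split wc∈
  ... | inj₁ (refl , _)  | inj₁ (refl , _)  = refl
  ... | inj₁ (refl , c∈) | inj₂ wc∈E        = contradiction (_ , wc∈E , swap v~w) (¬near c∈)
  ... | inj₂ vc∈E        | inj₁ (refl , c∈) = contradiction (_ , vc∈E , v~w) (¬near c∈)
  ... | inj₂ vc∈E        | inj₂ wc∈E        = proper valid vc∈E wc∈E v~w
  single′ : ∀ {v c d} → (v , c) ∈ E′ → (v , d) ∈ E′ → c ≡ d
  single′ vc∈ vd∈ with split vc∈ | split vd∈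
  ... | inj₁ (refl , c∈) | inj₁ (_ , d∈)    = ∈-firstWhere-unique L c∈ d∈
  ... | inj₁ (refl , c∈) | inj₂ vd∈E        = contradiction vd∈E y∉E
  ... | inj₂ vc∈E        | inj₁ (refl , d∈) = contradiction vc∈E y∉E
  ... | inj₂ vc∈E        | inj₂ vd∈E        = single valid vc∈E vd∈E
  old-near : ∀ {v c} → Near (_HasColourIn E) v c → Near (_HasColourIn E′) v c
  old-near (w , wc∈ , w~v) = w , ∈-++⁺ʳ _ wc∈ , w~v
  firstFit′ : ∀ {v c} → (v , c) ∈ E′ → FirstFit (Near (_HasColourIn E′) v) c L
  firstFit′ vc∈ with split vc∈
  ... | inj₁ (refl , c∈) =
    firstFit-map (λ _ unfree → old-near (clashes⁻ E y _ (not-false⁻ unfree)))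
      (proj₁ (firstWhere-firstFit L c∈))
  ... | inj₂ vc∈E = firstFit-map (λ _ → old-near) (firstFit valid vc∈E)

-- If every colour were blocked at `y`, then `firstFit-chain` would build from `y` and the coloured
-- strings a chain with more members than there are colours.
insert-covers : ∀ {T L E y} → Unique L → ¬ Chain T (suc (length L)) → T y → Valid T L E →
                ∃[ c ] (y , c) ∈ insert L E y
insert-covers {T} {L} {E} {y} L! short Ty valid with coloured E y in uncoloured
... | true  = coloured⁻ E y uncoloured
... | false with firstWhere-exhaustive {λ c → not (clashes E y c)} L
...   | inj₁ (c , c∈) = c , ∈-++⁺ˡ (∈-map⁺ _ c∈)
...   | inj₂ stuck = contradiction chain short
  where
  y∉E : ∀ {c} → (y , c) ∉ E
  y∉E yc∈ with () ← trans (sym uncoloured) (coloured⁺ yc∈)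
  origin⇒T : ∀ {v} → (v ≡ y ⊎ ∃[ c ] (v , c) ∈ E) → T v
  origin⇒T (inj₁ refl)      = Ty
  origin⇒T (inj₂ (c , vc∈)) = accepted valid vc∈
  chain : Chain T (suc (length L))
  chain with record { top = t ; members = K ; below = K≼t ; distinct = K! ; size = |K| ; P-top = Pt ; P-all = PK }
        ← firstFit-chain {_HasColourIn E} L L! (firstFit valid) (single valid) y y∉E
            (All.map (λ unfree → clashes⁻ E y _ (not-false⁻ unfree)) stuck) =
    record { top = t ; members = K ; below = K≼t ; distinct = K! ; size = |K|
           ; P-top = origin⇒T Pt ; P-all = All.map origin⇒T PK }

-- Colouring an enumerated set in stages

insertAccepted : (Str → Bool) → List Str → List (Str × Str) → List Str → List (Str × Str)
insertAccepted t L E ys = foldr (λ y E → if t y then insert L E y else E) E ys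

insertAccepted-⊆ : ∀ t L E ys {vc} → vc ∈ E → vc ∈ insertAccepted t L E ys
insertAccepted-⊆ t L E []       vc∈ = vc∈
insertAccepted-⊆ t L E (y ∷ ys) vc∈ with t y
... | true  = insert-⊆ L (insertAccepted t L E ys) y (insertAccepted-⊆ t L E ys vc∈)
... | false = insertAccepted-⊆ t L E ys vc∈

insertAccepted-valid : ∀ {T t L E} → (∀ {y} → t y ≡ true → T y) → Valid T L E → ∀ ys →
                       Valid T L (insertAccepted t L E ys)
insertAccepted-valid t⇒T valid []       = valid
insertAccepted-valid {t = t} t⇒T valid (y ∷ ys) with t y in ty
... | true  = insert-valid (t⇒T ty) (insertAccepted-valid t⇒T valid ys)
... | false = insertAccepted-valid t⇒T valid ys

insertAccepted-covers : ∀ {T t L E ys y} → Unique L → ¬ Chain T (suc (length L)) → (∀ {y} → t y ≡ true → T y) →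
                        Valid T L E → y ∈ ys → t y ≡ true → ∃[ c ] (y , c) ∈ insertAccepted t L E ys
insertAccepted-covers {ys = _ ∷ ys} L! short t⇒T valid (here refl) ty rewrite ty =
  insert-covers L! short (t⇒T ty) (insertAccepted-valid t⇒T valid ys)
insertAccepted-covers {t = t} {L} {E} {y′ ∷ ys} L! short t⇒T valid (there y∈) ty
  with c , yc∈ ← insertAccepted-covers {ys = ys} L! short t⇒T valid y∈ ty with t y′
... | true  = c , insert-⊆ L (insertAccepted t L E ys) y′ yc∈
... | false = c , yc∈

-- Dovetailing: each stage examines finitely many strings, yet a string gets its turn as soon as a
-- stage beyond its length accepts it.
colouring : (ℕ → Str → Bool) → List Str → ℕ → List (Str × Str)
colouring t L zero    = []
colouring t L (suc s) = insertAccepted (t s) L (colouring t L s) (stringsBelow s)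

colouring-valid : ∀ {T t L} → (∀ s {y} → t s y ≡ true → T y) → ∀ s → Valid T L (colouring t L s)
colouring-valid t⇒T zero    = record { accepted = λ () ; proper = λ () ; single = λ () ; firstFit = λ () }
colouring-valid t⇒T (suc s) = insertAccepted-valid (t⇒T s) (colouring-valid t⇒T s) (stringsBelow s)

colouring-mono : ∀ t L {s s′ vc} → s ≤ s′ → vc ∈ colouring t L s → vc ∈ colouring t L s′
colouring-mono t L {s} {s′} s≤s′ vc∈ with m≤n⇒m<n∨m≡n s≤s′
... | inj₂ refl = vc∈
colouring-mono t L {s′ = suc s′} _ vc∈ | inj₁ (s≤s s≤s′) =
  insertAccepted-⊆ (t s′) L _ (stringsBelow s′) (colouring-mono t L s≤s′ vc∈)

colouring-covers : ∀ {T t L s y} → Unique L → ¬ Chain T (suc (length L)) → (∀ s {y} → t s y ≡ true → T y) →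
                   length y < s → t s y ≡ true → ∃[ c ] (y , c) ∈ colouring t L (suc s)
colouring-covers {s = s} {y} L! short t⇒T |y|<s ty =
  insertAccepted-covers L! short (t⇒T s) (colouring-valid t⇒T s) (∈-stringsBelow⁺ y |y|<s) ty

-- Induction on `bs`: the preimage of the head is deleted from `as`, and by functionality it is not
-- the preimage of any later element.
pigeonhole : ∀ {A B : Set} {R : A → B → Set} → (∀ {a b b′} → R a b → R a b′ → b ≡ b′) →
             ∀ {bs as} → Unique bs → All (λ b → ∃[ a ] a ∈ as × R a b) bs → length bs ≤ length as
pigeonhole functional [] [] = z≤n
pigeonhole {R = R} functional {b ∷ bs} (b≢ ∷ bs!) ((a , a∈ , Rab) ∷ origins)
  with as₁ , as₂ , refl ← ∈-∃++ a∈ = begin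
  suc (length bs)               ≤⟨ s≤s (pigeonhole functional bs! (All.tabulate origin)) ⟩
  suc (length (as₁ ++ as₂))     ≡⟨ cong suc (length-++ as₁) ⟩
  suc (length as₁ + length as₂) ≡⟨ +-suc _ _ ⟨
  length as₁ + suc (length as₂) ≡⟨ length-++ as₁ ⟨
  length (as₁ ++ a ∷ as₂)       ∎
  where
  open ≤-Reasoning
  origin : ∀ {b′} → b′ ∈ bs → ∃[ a′ ] a′ ∈ as₁ ++ as₂ × R a′ b′
  origin b′∈ with a′ , a′∈ , Ra′b′ ← All.lookup origins b′∈ with ∈-++⁻ as₁ a′∈
  ... | inj₁ a′∈as₁         = a′ , ∈-++⁺ˡ a′∈as₁ , Ra′b′
  ... | inj₂ (there a′∈as₂) = a′ , ∈-++⁺ʳ as₁ a′∈as₂ , Ra′b′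
  ... | inj₂ (here refl)    = contradiction (functional Rab Ra′b′) (All.lookup b≢ b′∈)

-- The description mode given by an oracle machine

matchHeadᶜ : Computable {bool ⊗ str} {list str} (λ (b , w) → matchHead b w)
matchHeadᶜ = listrecᶜ {f = λ (b , w) → matchHead b w} []ᶜ
  (ifᶜ (ifᶜ fstᶜ (fstᶜ ∙ᶜ sndᶜ) (notᶜ (fstᶜ ∙ᶜ sndᶜ))) [ fstᶜ ∙ᶜ sndᶜ ∙ᶜ sndᶜ ]ᶜ []ᶜ)
  (λ _ → refl) (λ _ _ _ → refl)

isPrefixᶜ : Computable {str ⊗ str} {bool} (λ (u , v) → isPrefix u v)
isPrefixᶜ = anyᶜ (constᶜ true)
  (foldlᶜ
    (concatMapᶜ (matchHeadᶜ ∙ᶜ pairᶜ (sndᶜ ∙ᶜ sndᶜ ∙ᶜ fstᶜ) sndᶜ) (fstᶜ ∙ᶜ sndᶜ))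
    [ sndᶜ ]ᶜ fstᶜ)

swapᶜ : ∀ {A B} → Computable {A ⊗ B} {B ⊗ A} (λ (a , b) → b , a)
swapᶜ = pairᶜ sndᶜ fstᶜ

equalᶜ : Computable {str ⊗ str} {bool} (λ (u , v) → equal u v)
equalᶜ = ∧ᶜ isPrefixᶜ (isPrefixᶜ ∙ᶜ swapᶜ)

comparableᶜ : Computable {str ⊗ str} {bool} (λ (u , v) → comparable u v)
comparableᶜ = ∨ᶜ isPrefixᶜ (isPrefixᶜ ∙ᶜ swapᶜ)

prependᶜ : Computable {list str} {list str} prepend
prependᶜ =
  listrecᶜ {A = bool} {f = λ (_ , ws) → prepend ws} []ᶜ
    (∷ᶜ (∷ᶜ (constᶜ false) (fstᶜ ∙ᶜ sndᶜ)) (∷ᶜ (∷ᶜ (constᶜ true) (fstᶜ ∙ᶜ sndᶜ)) (sndᶜ ∙ᶜ sndᶜ ∙ᶜ sndᶜ)))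
    (λ _ → refl) (λ _ _ _ → refl)
  ∙ᶜ pairᶜ (constᶜ true) idᶜ

stringsᶜ : Computable {nat} {list str} strings
stringsᶜ =
  natrecᶜ {A = bool} {f = λ (_ , n) → strings n} [ []ᶜ ]ᶜ (prependᶜ ∙ᶜ sndᶜ ∙ᶜ sndᶜ) (λ _ → refl) (λ _ _ → refl)
  ∙ᶜ pairᶜ (constᶜ true) idᶜ

stringsBelowᶜ : Computable {nat} {list str} stringsBelow
stringsBelowᶜ =
  natrecᶜ {A = bool} {f = λ (_ , n) → stringsBelow n} []ᶜ (++ᶜ (stringsᶜ ∙ᶜ fstᶜ ∙ᶜ sndᶜ) (sndᶜ ∙ᶜ sndᶜ))
    (λ _ → refl) (λ _ _ → refl)
  ∙ᶜ pairᶜ (constᶜ true) idᶜ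

firstWhereᶜ : ∀ {A} {p : ⟦ A ⟧ → Str → Bool} {g : ⟦ A ⟧ → List Str} →
              Computable {A ⊗ str} {bool} (λ (a , c) → p a c) → Computable {A} {list str} g →
              Computable {A} {list str} (λ a → firstWhere (p a) (g a))
firstWhereᶜ p-comp g-comp =
  foldrᶜ (ifᶜ (p-comp ∙ᶜ pairᶜ fstᶜ (fstᶜ ∙ᶜ sndᶜ)) [ fstᶜ ∙ᶜ sndᶜ ]ᶜ (sndᶜ ∙ᶜ sndᶜ)) []ᶜ g-comp

insertᶜ : Computable {list str ⊗ list (str ⊗ str) ⊗ str} {list (str ⊗ str)} (λ (L , E , y) → insert L E y)
insertᶜ =
  ifᶜ (anyᶜ (equalᶜ ∙ᶜ pairᶜ (fstᶜ ∙ᶜ sndᶜ) (sndᶜ ∙ᶜ sndᶜ ∙ᶜ fstᶜ)) (fstᶜ ∙ᶜ sndᶜ))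
    (fstᶜ ∙ᶜ sndᶜ)
    (++ᶜ
      (mapᶜ (pairᶜ (sndᶜ ∙ᶜ sndᶜ ∙ᶜ fstᶜ) sndᶜ)
        (firstWhereᶜ
          (notᶜ (anyᶜ
            (∧ᶜ (equalᶜ ∙ᶜ pairᶜ (sndᶜ ∙ᶜ sndᶜ) (sndᶜ ∙ᶜ fstᶜ))
              (comparableᶜ ∙ᶜ pairᶜ (fstᶜ ∙ᶜ sndᶜ) (sndᶜ ∙ᶜ sndᶜ ∙ᶜ fstᶜ ∙ᶜ fstᶜ)))
            (fstᶜ ∙ᶜ sndᶜ ∙ᶜ fstᶜ)))
          fstᶜ))
      (fstᶜ ∙ᶜ sndᶜ))

-- The set `T n` of the overview.
Accepted : OracleMachine → ℕ → Str → Set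
Accepted U n y = ∀ X → X Extends y → ∃[ q ] q ∈ stringsBelow n × X ⊢ U ⟨ q ⟩⇓ y

-- The finite test behind the enumeration of `Accepted`: each extension of `y` by `s` bits, used as
-- oracle part, must already let some short program output `y`.
accepts : OracleMachine → ℕ → ℕ → Str → Bool
accepts U n s y =
  all (λ e → any (λ q → any (λ u → equal u y) (approx U (y ++ e) q)) (stringsBelow n)) (strings s)

acceptsᶜ : ∀ U → Computable {nat ⊗ nat ⊗ str} {bool} (λ (n , s , y) → accepts U n s y)
acceptsᶜ U =
  allᶜ
    (anyᶜ
      (anyᶜ (equalᶜ ∙ᶜ pairᶜ sndᶜ (sndᶜ ∙ᶜ sndᶜ ∙ᶜ fstᶜ ∙ᶜ fstᶜ ∙ᶜ fstᶜ))
        (approxᶜ U ∙ᶜ pairᶜ (++ᶜ (sndᶜ ∙ᶜ sndᶜ ∙ᶜ fstᶜ ∙ᶜ fstᶜ) (sndᶜ ∙ᶜ fstᶜ)) sndᶜ))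
      (stringsBelowᶜ ∙ᶜ fstᶜ ∙ᶜ fstᶜ))
    (stringsᶜ ∙ᶜ fstᶜ ∙ᶜ sndᶜ)

accepts-sound : ∀ U n s {y} → accepts U n s y ≡ true → Accepted U n y
accepts-sound U n s {y} acc X ext
  -- The `s` bits of `X` after `y` form one of the extensions that were tested.
  with e ← applyUpTo (X ∘ (length y +_)) s in e-def
  = output
  where
  e∈ : e ∈ strings s
  e∈ = subst (λ n → e ∈ strings n) (trans (cong length (sym e-def)) (length-applyUpTo _ s)) (∈-strings⁺ e)
  extends : X Extends (y ++ e)
  extends =
    subst (X Extends_) (trans (applyUpTo-+ X (length y) s) (cong₂ _++_ ext e-def))
      (Extends-applyUpTo X (length y + s))
  output : ∃[ q ] q ∈ stringsBelow n × X ⊢ U ⟨ q ⟩⇓ y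
  output
    with q , q∈ , found ← any⁻ (stringsBelow n) (all⁻ acc e∈)
    with u , u∈ , u≡y ← any⁻ (approx U (y ++ e) q) found
    with refl ← equal⁻ u y u≡y = q , q∈ , approx-sound U extends u∈

-- Different `X` may use different programs `q`; the existential over `q` is therefore part of the
-- predicate given to `compactness`.
accepts-complete : ExcludedMiddle 0ℓ → ∀ U {n y} → Accepted U n y → Eventually λ s → accepts U n s y ≡ true
accepts-complete em U {n} {y} accepted
  with s₀ , secured ← compactness em {λ w → ∃[ q ] q ∈ stringsBelow n × y ∈ approx U w q}
         (λ w (q , q∈ , y∈) → q , q∈ , approx-mono U w y∈) y
         (λ X ext → let q , q∈ , ⇓y = accepted X ext ; k , y∈ = approx-complete ⇓y in
           k , λ k≤ → q , q∈ , y∈ k≤) =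
  s₀ , λ {s} s₀≤s → all⁺ (strings s) λ e∈ → let q , q∈ , y∈ = secured s₀≤s (∈-strings⁻ s e∈) in
    any⁺ q∈ (any⁺ y∈ (equal-refl y))

-- With the fixed oracle `top ⌢ ∅` distinct outputs need distinct programs, and 2^n + 1 members face
-- only 2^n - 1 programs. Any continuation of `top` would do in place of `∅`.
accepted-chains-short : ∀ {U n} → ¬ Chain (Accepted U n) (suc (length (strings n)))
accepted-chains-short {U} {n} chain = 1+n≰n (begin
  suc (length (stringsBelow n))   ≤⟨ n≤1+n _ ⟩
  suc (suc (length (stringsBelow n))) ≡⟨ cong suc (length-stringsBelow n) ⟩
  suc (length (strings n))        ≡⟨ size ⟨
  length members                  ≤⟨ pigeonhole (⇓-deterministic {top ⌢ ∅} {f = U}) distinct outputs ⟩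
  length (stringsBelow n)         ∎)
  where
  open Chain chain
  open ≤-Reasoning
  outputs : All (λ u → ∃[ q ] q ∈ stringsBelow n × (top ⌢ ∅) ⊢ U ⟨ q ⟩⇓ u) members
  outputs = All.zipWith (λ (accepted , u≼top) → accepted _ (Extends-≼ (⌢-Extends top) u≼top)) (P-all , below)

programColouring : OracleMachine → ℕ → ℕ → List (Str × Str)
programColouring U n = colouring (accepts U n) (strings n)

programColouringᶜ : ∀ U → Computable {nat ⊗ nat} {list (str ⊗ str)} (λ (n , s) → programColouring U n s)
programColouringᶜ U = natrecᶜ {f = λ (n , s) → programColouring U n s} []ᶜ
  (foldrᶜ
    (ifᶜ (acceptsᶜ U ∙ᶜ pairᶜ (fstᶜ ∙ᶜ fstᶜ) (pairᶜ (fstᶜ ∙ᶜ sndᶜ ∙ᶜ fstᶜ) (fstᶜ ∙ᶜ sndᶜ)))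
      (insertᶜ ∙ᶜ pairᶜ (stringsᶜ ∙ᶜ fstᶜ ∙ᶜ fstᶜ) (pairᶜ (sndᶜ ∙ᶜ sndᶜ) (fstᶜ ∙ᶜ sndᶜ)))
      (sndᶜ ∙ᶜ sndᶜ))
    (sndᶜ ∙ᶜ sndᶜ) (stringsBelowᶜ ∙ᶜ fstᶜ ∙ᶜ sndᶜ))
  (λ _ → refl) (λ _ _ → refl)

programColouring-valid : ∀ U n s → Valid (Accepted U n) (strings n) (programColouring U n s)
programColouring-valid U n = colouring-valid (accepts-sound U n)

least-true : ∀ (h : ℕ → Bool) n → h n ≡ true → ∃[ k ] h k ≡ true × (∀ m → m < k → h m ≡ false)
least-true h zero    hn = zero , hn , λ _ ()
least-true h (suc n) hn with h 0 in h0
... | true  = zero , h0 , λ _ ()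
... | false with k , hk , below ← least-true (h ∘ suc) n hn =
  suc k , hk , λ { zero _ → h0 ; (suc m) (s≤s m<k) → below m m<k }

minimize-halts : ∀ {X A} {f : Program (A ⊗ nat) bool} {a h} → (∀ n → X ⊢ f ⟨ a , n ⟩⇓ h n) →
                 ∀ n → h n ≡ true → ∃[ k ] h k ≡ true × X ⊢ minimize f ⟨ a ⟩⇓ k
minimize-halts {X} {h = h} ⇓h n hn with k , hk , below ← least-true h n hn =
  k , hk , minimize⇓ (λ m m<k → subst (X ⊢ _ ⟨ _ ⟩⇓_) (below m m<k) (⇓h m)) (subst (X ⊢ _ ⟨ _ ⟩⇓_) hk (⇓h k))

semidecidable : ∀ {A} {h : ⟦ A ⊗ nat ⟧ → Bool} → Computable {A ⊗ nat} {bool} h →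
                Σ[ f ∈ Program A bool ] ∀ a → (∃[ n ] h (a , n) ≡ true) ⇔ (∃[ b ] ∅ ⊢ f ⟨ a ⟩⇓ b)
semidecidable {h = h} (computable H ⇓h) = const true ∙ minimize H , λ a → mk⇔
  (λ (n , hn) → case minimize-halts (λ n → ⇓h ∅ (a , n)) n hn of λ (_ , _ , ⇓k) → true , ∙⇓ ⇓k const⇓)
  (λ { (_ , ∙⇓ (minimize⇓ {n = n} _ ⇓true) _) → n , ⇓-deterministic (⇓h ∅ (a , n)) ⇓true })

abstract
  -- A description of `y` is its colour. The parameter `n` is recovered as `length p`, so a single
  -- mode handles the colourings for all `n`.
  colouringMode : OracleMachine → DescriptionMode
  colouringMode U = record
    { Describes  = Describes′
    ; ce         = f , λ p x y → mk⇔ (Equivalence.to (f-correct (p , x , y)) ∘ holds⁺)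
                                     (holds⁻ ∘ Equivalence.from (f-correct (p , x , y)))
    -- Both strings are prefixes of `x`, hence comparable, and at stage `s ⊔ s′` both have colour
    -- `p`.
    ; functional = λ {p} (y≼x , s , yp∈) (y′≼x , s′ , y′p∈) →
        proper (programColouring-valid U (length p) (s ⊔ s′))
          (grow (length p) (m≤m⊔n s s′) yp∈) (grow (length p) (m≤n⊔m s s′) y′p∈)
          (prefixes-comparable y≼x y′≼x)
    ; monotone   = λ x≼x′ (y≼x , described) → ≼-trans y≼x x≼x′ , described
    }
    where
    grow : ∀ n {s s′ vc} → s ≤ s′ → vc ∈ programColouring U n s → vc ∈ programColouring U n s′
    grow n = colouring-mono (accepts U n) (strings n)
    Describes′ : Str → Str → Str → Set
    Describes′ p x y = y IsPrefixOf x × ∃[ s ] (y , p) ∈ programColouring U (length p) s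
    holds : ⟦ (str ⊗ str ⊗ str) ⊗ nat ⟧ → Bool
    holds ((p , x , y) , s) =
      isPrefix y x ∧ any (λ (v , c) → equal v y ∧ equal c p) (programColouring U (length p) s)
    holdsᶜ : Computable {(str ⊗ str ⊗ str) ⊗ nat} {bool} holds
    holdsᶜ =
      ∧ᶜ (isPrefixᶜ ∙ᶜ pairᶜ (sndᶜ ∙ᶜ sndᶜ ∙ᶜ fstᶜ) (fstᶜ ∙ᶜ sndᶜ ∙ᶜ fstᶜ))
        (anyᶜ
          (∧ᶜ (equalᶜ ∙ᶜ pairᶜ (fstᶜ ∙ᶜ sndᶜ) (sndᶜ ∙ᶜ sndᶜ ∙ᶜ fstᶜ ∙ᶜ fstᶜ))
            (equalᶜ ∙ᶜ pairᶜ (sndᶜ ∙ᶜ sndᶜ) (fstᶜ ∙ᶜ fstᶜ ∙ᶜ fstᶜ)))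
          (programColouringᶜ U ∙ᶜ pairᶜ (lengthᶜ ∙ᶜ fstᶜ ∙ᶜ fstᶜ) sndᶜ))
    f : Program (str ⊗ str ⊗ str) bool
    f = proj₁ (semidecidable holdsᶜ)
    f-correct : ∀ a → (∃[ s ] holds (a , s) ≡ true) ⇔ (∃[ b ] ∅ ⊢ f ⟨ a ⟩⇓ b)
    f-correct = proj₂ (semidecidable holdsᶜ)
    holds⁺ : ∀ {p x y} → Describes′ p x y → ∃[ s ] holds ((p , x , y) , s) ≡ true
    holds⁺ {p} {x} {y} (y≼x , s , yp∈) =
      s , cong₂ _∧_ (isPrefix⁺ y≼x) (any⁺ yp∈ (cong₂ _∧_ (equal-refl y) (equal-refl p)))
    holds⁻ : ∀ {p x y} → ∃[ s ] holds ((p , x , y) , s) ≡ true → Describes′ p x y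
    holds⁻ {p} {x} {y} (s , eq)
      with y≼x , found ← ∧-true⁻ {isPrefix y x} eq
      with (v , c) , vc∈ , both ← any⁻ (programColouring U (length p) s) found
      with v≡y , c≡p ← ∧-true⁻ {equal v y} both
      with refl ← equal⁻ v y v≡y | refl ← equal⁻ c p c≡p = isPrefix⁻ y x y≼x , s , vc∈

  accepted⇒described : ExcludedMiddle 0ℓ → ∀ U {n x} → Accepted U n x →
                       ∃[ p ] length p ≡ n × Describes (colouringMode U) p x x
  accepted⇒described em U {n} {x} accepted
    with s₀ , accepts-at ← accepts-complete em U {n} accepted
    -- From `s₀` on the test succeeds; beyond `length x` the stage also examines `x`.
    with s ← s₀ ⊔ suc (length x) in s-def
    with p , xp∈ ← colouring-covers (strings-unique n) (accepted-chains-short {U} {n}) (accepts-sound U n)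
           (subst (length x <_) s-def (m≤n⊔m s₀ (suc (length x)))) (accepts-at (subst (s₀ ≤_) s-def (m≤m⊔n s₀ _)))
    with refl ← ∈-strings⁻ n (firstFit⇒∈ (Valid.firstFit (programColouring-valid U n (suc s)) xp∈)) =
    p , refl , ≼-refl , suc s , xp∈

-- The oracle machine given by a description mode

oraclePrefix : Program nat str
oraclePrefix =
  natrec nil (program (++ᶜ fstᶜ [ sndᶜ ]ᶜ) ∙ pair (snd ∙ snd) (query ∙ fst ∙ snd)) ∙ pair (const true) idn

oraclePrefix⇓ : ∀ X n → X ⊢ oraclePrefix ⟨ n ⟩⇓ applyUpTo X n
oraclePrefix⇓ X n = ∙⇓ (pair⇓ const⇓ idn⇓) (run n)
  where
  run : ∀ n → X ⊢ natrec nil _ ⟨ true , n ⟩⇓ applyUpTo X n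
  run zero    = natrec⇓₀ nil⇓
  run (suc n) = subst (X ⊢ _ ⟨ _ ⟩⇓_) (applyUpTo-∷ʳ X n)
    (natrec⇓₁ (run n)
      (∙⇓ (pair⇓ (∙⇓ snd⇓ snd⇓) (∙⇓ (∙⇓ snd⇓ fst⇓) query⇓)) (computes (++ᶜ fstᶜ [ sndᶜ ]ᶜ) X _)))

-- The default is never output by the machine, since its search stops only at a nonempty list.
firstOr[] : List Str → Str
firstOr[] = foldr (λ y _ → y) []

firstOr[]-∈ : ∀ {ys y} → (∀ {y′} → y′ ∈ ys → y′ ≡ y) → any (λ _ → true) ys ≡ true → firstOr[] ys ≡ y
firstOr[]-∈ {_ ∷ _} all-y _ = all-y (here refl)

-- The program `f` enumerates the mode with oracle `∅`, but the machine runs with oracle `X`. Hence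
-- `f` is not called directly: it is evaluated by `approx` on an all-false oracle part.
candidates : Program (str ⊗ str ⊗ str) bool → Str → Str → List Str
candidates f p w =
  concatMap
    (λ y → if any (λ x → isPrefix x w ∧ any (λ _ → true) (approx f (applyUpTo ∅ (length w)) (p , x , y)))
                (stringsBelow (length w))
           then [ y ] else [])
    (stringsBelow (length w))

∅-prefixᶜ : Computable {nat} {str} (applyUpTo ∅)
∅-prefixᶜ =
  natrecᶜ {A = bool} {f = λ (_ , n) → applyUpTo ∅ n} []ᶜ (∷ᶜ (constᶜ false) (sndᶜ ∙ᶜ sndᶜ)) (λ _ → refl) (λ _ _ → refl)
  ∙ᶜ pairᶜ (constᶜ true) idᶜ

candidatesᶜ : ∀ f → Computable {str ⊗ str} {list str} (λ (p , w) → candidates f p w)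
candidatesᶜ f =
  concatMapᶜ
    (ifᶜ
      (anyᶜ
        (∧ᶜ (isPrefixᶜ ∙ᶜ pairᶜ sndᶜ (sndᶜ ∙ᶜ fstᶜ ∙ᶜ fstᶜ))
          (anyᶜ (constᶜ true)
            (approxᶜ f ∙ᶜ pairᶜ (∅-prefixᶜ ∙ᶜ lengthᶜ ∙ᶜ sndᶜ ∙ᶜ fstᶜ ∙ᶜ fstᶜ)
              (pairᶜ (fstᶜ ∙ᶜ fstᶜ ∙ᶜ fstᶜ) (pairᶜ sndᶜ (sndᶜ ∙ᶜ fstᶜ))))))
        (stringsBelowᶜ ∙ᶜ lengthᶜ ∙ᶜ sndᶜ ∙ᶜ fstᶜ))
      [ sndᶜ ]ᶜ []ᶜ)
    (stringsBelowᶜ ∙ᶜ lengthᶜ ∙ᶜ sndᶜ)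

anyCandidateᶜ : ∀ f → Computable {str ⊗ str} {bool} (λ (p , w) → any (λ _ → true) (candidates f p w))
anyCandidateᶜ f = anyᶜ (constᶜ true) (candidatesᶜ f)

firstCandidateᶜ : ∀ f → Computable {str ⊗ str} {str} (λ (p , w) → firstOr[] (candidates f p w))
firstCandidateᶜ f = foldrᶜ (fstᶜ ∙ᶜ sndᶜ) []ᶜ (candidatesᶜ f)

abstract
  modeMachine : DescriptionMode → OracleMachine
  modeMachine D =
    program (firstCandidateᶜ f) ∙
    pair idn (oraclePrefix ∙ minimize (program (anyCandidateᶜ f) ∙ pair fst (oraclePrefix ∙ snd)))
    where
    f : Program (str ⊗ str ⊗ str) bool
    f = proj₁ (ce D)

  -- The machine does not know where `x` ends in `X`, and its search may stop earlier, at another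
  -- condition `x′`. Monotonicity moves both triples to the longer of `x` and `x′`, where
  -- functionality identifies the outputs.
  modeMachine-simulates : ∀ D {p x y X} → Describes D p x y → X Extends x → X ⊢ modeMachine D ⟨ p ⟩⇓ y
  modeMachine-simulates D {p} {x} {y} {X} described ext =
    let f , f-correct  = ce D
        b , ⇓b         = Equivalence.to (f-correct p x y) described
        n₀ , b∈        = approx-complete ⇓b
        -- At length `n₀ ⊔ l` the prefix of `X` is longer than `x` and `y`, so both are tried, and
        -- the evaluation of `f` has succeeded.
        l              = suc (length x) ⊔ suc (length y)
        |x|<l          = m≤m⊔n (suc (length x)) (suc (length y))
        |y|<l          = m≤n⊔m (suc (length x)) (suc (length y))
        y∈             = is-candidate (n₀ ⊔ l) (b∈ (m≤m⊔n n₀ l))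
                           (≤-trans |x|<l (m≤n⊔m n₀ l)) (≤-trans |y|<l (m≤n⊔m n₀ l))
        k , found , ⇓k =
          minimize-halts {f = program (anyCandidateᶜ f) ∙ pair fst (oraclePrefix ∙ snd)}
            {h = λ n → any (λ _ → true) (candidates f p (applyUpTo X n))}
            (λ n → ∙⇓ (pair⇓ fst⇓ (∙⇓ snd⇓ (oraclePrefix⇓ X n))) (computes (anyCandidateᶜ f) X _))
            (n₀ ⊔ l) (any⁺ y∈ refl)
    in subst (X ⊢ modeMachine D ⟨ p ⟩⇓_) (firstOr[]-∈ (only-candidate k) found)
         (∙⇓ (pair⇓ idn⇓ (∙⇓ ⇓k (oraclePrefix⇓ X k))) (computes (firstCandidateᶜ f) X _))
    where
    is-candidate : ∀ n {b} → b ∈ approx (proj₁ (ce D)) (applyUpTo ∅ n) (p , x , y) →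
                   length x < n → length y < n → y ∈ candidates (proj₁ (ce D)) p (applyUpTo X n)
    is-candidate n b∈ |x|<n |y|<n rewrite length-applyUpTo X n =
      concatMap⁺ (∈-stringsBelow⁺ y |y|<n)
        (if-singleton⁺
          (any⁺ (∈-stringsBelow⁺ x |x|<n)
            (cong₂ _∧_ (isPrefix⁺ (Extends⇒≼ ext (<⇒≤ |x|<n))) (any⁺ b∈ refl))))
    only-candidate : ∀ k {y′} → y′ ∈ candidates (proj₁ (ce D)) p (applyUpTo X k) → y′ ≡ y
    only-candidate k {y′} y′∈
      with y″ , _ , y′∈ ← concatMap⁻ (stringsBelow (length (applyUpTo X k))) y′∈
      with test , refl ← if-singleton⁻ y′∈
      with x′ , _ , both ← any⁻ (stringsBelow (length (applyUpTo X k))) test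
      with x′≼ , halts ← ∧-true⁻ {isPrefix x′ (applyUpTo X k)} both
      with b , b∈ , _ ← any⁻ (approx (proj₁ (ce D)) _ (p , x′ , y′)) halts = same (Extends⇒Comparable ext-x′ ext)
      where
      described′ : Describes D p x′ y′
      described′ = Equivalence.from (proj₂ (ce D) p x′ y′) (b , approx-sound (proj₁ (ce D)) (Extends-applyUpTo ∅ _) b∈)
      ext-x′ : X Extends x′
      ext-x′ = Extends-≼ (Extends-applyUpTo X k) (isPrefix⁻ x′ _ x′≼)
      same : Comparable x′ x → y′ ≡ y
      same (inj₁ x′≼x) = functional D (monotone D x′≼x described′) described
      same (inj₂ x≼x′) = functional D described′ (monotone D x≼x′ described)

-- Comparison of the complexities

minimum-exists : ExcludedMiddle 0ℓ → ∀ {P : ℕ → Set} n → P n → ∃[ k ] IsMinimum P k × k ≤ n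
minimum-exists em {P} zero P0 = 0 , (P0 , λ _ _ → z≤n) , z≤n
minimum-exists em {P} (suc n) Pn with em {P 0}
... | yes P0 = 0 , (P0 , λ _ _ → z≤n) , z≤n
... | no ¬P0 with k , (Pk , k≤) , k≤n ← minimum-exists em {P ∘ suc} n Pn =
  suc k , (Pk , λ { zero P0 → contradiction P0 ¬P0 ; (suc m) Pm → s≤s (k≤ m Pm) }) , s≤s k≤n

maximum-exists : ExcludedMiddle 0ℓ → ∀ {P : ℕ → Set} {n} bound → P n → (∀ {m} → P m → m ≤ bound) →
                 ∃[ k ] P k × (∀ {m} → P m → m ≤ k)
maximum-exists em {P} {n} zero Pn P≤ with refl ← n≤0⇒n≡0 (P≤ Pn) = 0 , Pn , P≤
maximum-exists em {P} (suc bound) Pn P≤ with em {P (suc bound)}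
... | yes P-bound = suc bound , P-bound , P≤
... | no ¬P-bound = maximum-exists em bound Pn
  λ Pm → m<1+n⇒m≤n (≤∧≢⇒< (P≤ Pm) λ { refl → ¬P-bound Pm })

idn-complexity : ∀ X x → OracleComplexity idn X x (length x)
idn-complexity X x = (x , refl , idn⇓) , λ { _ (_ , refl , idn⇓) → ≤-refl }

∣k-m∣≤ : ∀ {k m a b} → k ≤ m + a → m ≤ k + b → ∣ k - m ∣ ≤ a + b
∣k-m∣≤ {k} {m} {a} {b} k≤ m≤ with ≤-total k m
... | inj₁ k≤m = ≤-trans (≤-reflexive (m≤n⇒∣m-n∣≡n∸m k≤m)) (≤-trans (m≤n+o⇒m∸n≤o m k m≤) (m≤n+m b a))
... | inj₂ m≤k = ≤-trans (≤-reflexive (m≤n⇒∣n-m∣≡n∸m m≤k)) (≤-trans (m≤n+o⇒m∸n≤o k m k≤) (m≤m+n a b))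

complexity-≤ : ∀ {U X x n b} → OracleComplexity U X x n → (∃[ n′ ] OracleComplexity U X x n′ × n′ ≤ b) → n ≤ b
complexity-≤ (_ , n≤) (n′ , (attained , _) , n′≤b) = ≤-trans (n≤ n′ attained) n′≤b

-- Optimality against the identity machine bounds the complexity by `length x + c` for all `X` at
-- once, which gives both finiteness and a bounded set of values.
maxOracleComplexity-exists : ExcludedMiddle 0ℓ → ∀ U → OptimalMachine U → ∀ x → ∃[ m ] MaxOracleComplexity U x m
maxOracleComplexity-exists em U U-optimal x
  with c , U≤idn ← U-optimal idn
  with _ , C₀ , _ ← U≤idn (x ⌢ ∅) x (length x) (idn-complexity (x ⌢ ∅) x)
  with m , attained , m-max ←
         maximum-exists em {λ m → ∃[ X ] X Extends x × OracleComplexity U X x m} (length x + c)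
           (x ⌢ ∅ , ⌢-Extends x , C₀)
           (λ (X , _ , C) → complexity-≤ {U} C (U≤idn X x (length x) (idn-complexity X x))) =
  m , attained , bounded
  where
  bounded : ∀ X → X Extends x → ∃[ n ] OracleComplexity U X x n × n ≤ m
  bounded X ext with n , C , _ ← U≤idn X x (length x) (idn-complexity X x) = n , C , m-max (X , ext , C)

-- The index is `suc m` because `Accepted` counts programs strictly shorter than its index.
maxOracleComplexity⇒accepted : ∀ {U x m} → MaxOracleComplexity U x m → Accepted U (suc m) x
maxOracleComplexity⇒accepted (_ , bounded) X ext
  with n , ((q , refl , ⇓x) , _) , n≤m ← bounded X ext = q , ∈-stringsBelow⁺ q (s≤s n≤m) , ⇓x

condComplexity-upper : ExcludedMiddle 0ℓ → ∀ D → OptimalMode D → ∀ U →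
  ∃[ c ] ∀ x m → MaxOracleComplexity U x m → ∃[ k ] CondComplexity D x x k × k ≤ m + c
-- `c` is the price of replacing `colouringMode U` by `D`; the successor comes from colours of
-- length `m + 1`.
condComplexity-upper em D D-optimal U with c , D≤ ← D-optimal (colouringMode U) = suc c , bound
  where
  bound : ∀ x m → MaxOracleComplexity U x m → ∃[ k ] CondComplexity D x x k × k ≤ m + suc c
  bound x m max
    with p , |p| , described ← accepted⇒described em U {suc m} (maxOracleComplexity⇒accepted {U} max)
    with n , C , n≤ ← minimum-exists em (suc m) (p , |p| , described)
    with k , Cₖ , k≤ ← D≤ x x n C =
    k , Cₖ , ≤-trans k≤ (≤-trans (+-monoˡ-≤ c n≤) (≤-reflexive (sym (+-suc m c))))

-- A shortest description of `x` is itself a program for `modeMachine D`, and it is run on a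
-- sequence `X` that attains the maximum.
condComplexity-lower : ExcludedMiddle 0ℓ → ∀ D U → OptimalMachine U →
  ∃[ c ] ∀ x k m → CondComplexity D x x k → MaxOracleComplexity U x m → m ≤ k + c
condComplexity-lower em D U U-optimal with c , U≤ ← U-optimal (modeMachine D) = c , bound
  where
  bound : ∀ x k m → CondComplexity D x x k → MaxOracleComplexity U x m → m ≤ k + c
  bound x k m ((p , |p| , described) , _) ((X , ext , C) , _)
    with n , Cₙ , n≤ ← minimum-exists em k (p , |p| , modeMachine-simulates D described ext) =
    ≤-trans (complexity-≤ {U} C (U≤ X x n Cₙ)) (+-monoˡ-≤ c n≤)

theorem6 : ExcludedMiddle 0ℓ →
    (D : DescriptionMode) → OptimalMode D →
    (U : OracleMachine) → OptimalMachine U →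
    ∃[ c ] ∀ (x : Str) → ∃[ k ] ∃[ m ]
    CondComplexity D x x k × MaxOracleComplexity U x m × ∣ k - m ∣ ≤ c
theorem6 em D D-optimal U U-optimal
  with a , upper ← condComplexity-upper em D D-optimal U
  with b , lower ← condComplexity-lower em D U U-optimal = a + b , bound
  where
  bound : ∀ x → ∃[ k ] ∃[ m ] CondComplexity D x x k × MaxOracleComplexity U x m × ∣ k - m ∣ ≤ a + b
  bound x
    with m , max ← maxOracleComplexity-exists em U U-optimal x
    -- That `D` describes `x` under the condition `x` at all comes from the upper bound too.
    with k , C , k≤ ← upper x m max =
    k , m , C , max , ∣k-m∣≤ k≤ (lower x k m C max)
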